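{- Let $k\leq 8$ be a positive integer. Then the set of odd positive integers $n$ with $s_2(n^2)=s_2(n)=k$ is finite.
   Context: $s_2(m)$ denotes the sum of the binary digits of the nonnegative integer $m$. -}

module Defs where

open import Data.Nat using (ℕ; zero; suc; _+_; _/_; _%_)

-- Binary digit sum with fuel: s₂-aux f m computes the sum of binary digits of m
-- whenever f ≥ m (each step halves m, and m ≥ 1 needs a step).
s₂-aux : ℕ → ℕ → ℕ
s₂-aux zero    m = 0
s₂-aux (suc f) m = m % 2 + s₂-aux f (m / 2)

-- s₂ m = sum of the binary digits of m (fuel m suffices since m/2 < m for m ≥ 1).
s₂ : ℕ → ℕ
s₂ m = s₂-aux m m

{-# OPTIONS --safe #-}
module Submission where

-- Write n as the sum of 2^r over k ≤ 8 exponents r, with largest exponent R. If R is huge, Dirichlet's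
-- approximation theorem applied to the fractions r/R provides L ≤ R and T such that every r + T lies in a
-- short interval just above a multiple of L. Hence 2ᵀn = P(2ᴸ) for a polynomial P with at least two terms
-- and coefficients so small that neither 2ᵀn nor its square has carries in base 2ᴸ. So s₂ (n) and s₂ (n²)
-- are the sums of the digit sums of the coefficients of P and of P².
--
-- If P = Σ bᵢ x^aᵢ with h terms, a₁ < … < aₕ, then P² has nonzero coefficients at the 2h − 1 degrees
-- 2a₁ < a₁ + a₂ < 2a₂ < … < 2aₕ, and the two lowest and two highest ones are b₁², 2b₁b₂, 2bₕ₋₁bₕ, bₕ².
-- For h ≥ 5 this exceeds 8. For h = 3, 4 it suffices to know that s₂ (xy) = 1 only for powers of two and that
-- s₂ (x²) = 2 only for x = 3 (up to powers of two). For h = 2 one also has to exclude s₂ (x²) = s₂ (y²) = 3,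
-- s₂ (xy) = 2 and to treat y = 3, which is done with congruences.

open import Defs
open import Data.Nat
open import Data.Nat.Properties
open import Data.Nat.DivMod
open import Data.Nat.ListAction using (sum)
open import Data.Nat.Tactic.RingSolver using (solve-∀)
open import Data.Fin.Base as Fin using (Fin; toℕ; fromℕ<; funToFin; finToFun)
open import Data.Fin.Properties using (pigeonhole; finToFun-funToFin; toℕ-fromℕ<; toℕ<n)
open import Data.List.Base using (List; []; _∷_; map; length; lookup)
open import Data.List.Extrema ≤-totalOrder using (max; argmax-sel; xs≤max)
open import Data.List.Membership.Propositional using (_∈_)
open import Data.List.Properties using (length-map)
open import Data.List.Relation.Unary.All as All using (All; []; _∷_)
open import Data.List.Relation.Unary.Any using (here; there)
open import Data.Empty using (⊥)
open import Data.Product using (∃; ∃₂; _×_; _,_; proj₁; proj₂)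
open import Data.Sum using (_⊎_; inj₁; inj₂)
open import Function using (_∘_; id)
open import Relation.Binary.Definitions using (tri<; tri≈; tri>)
open import Relation.Binary.PropositionalEquality hiding (J)
open import Relation.Nullary using (¬_; yes; no; contradiction)
open import Relation.Nullary.Decidable using (toWitness; _⊎-dec_)

-- Binary digit sums

s₂-aux-zero : ∀ f → s₂-aux f 0 ≡ 0
s₂-aux-zero zero    = refl
s₂-aux-zero (suc f) = s₂-aux-zero f

half≤ : ∀ {m f} → m ≤ suc f → m / 2 ≤ f
half≤ {zero}  _  = z≤n
half≤ {suc m} le = ≤-pred (≤-trans (m/n<m (suc m) 2 ≤-refl) le)

s₂-aux-fuel : ∀ f g {m} → m ≤ f → m ≤ g → s₂-aux f m ≡ s₂-aux g m
s₂-aux-fuel zero    g       z≤n _   = sym (s₂-aux-zero g)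
s₂-aux-fuel (suc f) zero    _   z≤n = s₂-aux-zero (suc f)
s₂-aux-fuel (suc f) (suc g) {m} p q = cong (m % 2 +_) (s₂-aux-fuel f g (half≤ p) (half≤ q))

s₂-rec : ∀ m → s₂ m ≡ m % 2 + s₂ (m / 2)
s₂-rec zero      = refl
s₂-rec m@(suc f) = cong (m % 2 +_) (s₂-aux-fuel f (m / 2) (half≤ ≤-refl) ≤-refl)

s₂-even : ∀ m → s₂ (2 * m) ≡ s₂ m
s₂-even m = begin
  s₂ (2 * m)                     ≡⟨ cong s₂ (*-comm 2 m) ⟩
  s₂ (m * 2)                     ≡⟨ s₂-rec (m * 2) ⟩
  m * 2 % 2 + s₂ (m * 2 / 2)     ≡⟨ cong₂ (λ r q → r + s₂ q) (m*n%n≡0 m 2) (m*n/n≡m m 2) ⟩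
  s₂ m                           ∎
  where open ≡-Reasoning

s₂-odd : ∀ m → s₂ (1 + 2 * m) ≡ 1 + s₂ m
s₂-odd m = begin
  s₂ (1 + 2 * m)                         ≡⟨ cong (s₂ ∘ suc) (*-comm 2 m) ⟩
  s₂ (1 + m * 2)                         ≡⟨ s₂-rec (1 + m * 2) ⟩
  (1 + m * 2) % 2 + s₂ ((1 + m * 2) / 2) ≡⟨ cong₂ (λ r q → r + s₂ q) ([m+kn]%n≡m%n 1 m 2) quot ⟩
  1 + s₂ m                               ∎
  where
  open ≡-Reasoning
  quot : (1 + m * 2) / 2 ≡ m
  quot = trans (+-distrib-/ 1 (m * 2) (subst (λ r → 1 + r < 2) (sym (m*n%n≡0 m 2)) ≤-refl))
               (m*n/n≡m m 2)

-- Supports induction on binary digits. Leading zeros are allowed (`double 0ᵇ`), so the value 0 has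
-- to be excluded separately where it matters.
data Binary : ℕ → Set where
  0ᵇ     : Binary 0
  double : ∀ {m} → Binary m → Binary (2 * m)
  1+2×_  : ∀ {m} → Binary m → Binary (1 + 2 * m)

binary : ∀ n → Binary n
binary zero    = 0ᵇ
binary (suc n) = increment (binary n)
  where
  increment : ∀ {m} → Binary m → Binary (suc m)
  increment 0ᵇ             = 1+2× 0ᵇ
  increment (double b)     = 1+2× b
  increment (1+2×_ {m} b)  = subst Binary (*-distribˡ-+ 2 1 m) (double (increment b))

s₂≡0⇒≡0 : ∀ {n} → s₂ n ≡ 0 → n ≡ 0
s₂≡0⇒≡0 {n} eq = go (binary n) eq
  where
  go : ∀ {n} → Binary n → s₂ n ≡ 0 → n ≡ 0
  go 0ᵇ             _  = refl
  go (double {m} b) eq = cong (2 *_) (go b (trans (sym (s₂-even m)) eq))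
  go (1+2×_ {m} b)  eq = contradiction (trans (sym (s₂-odd m)) eq) λ ()

s₂>0 : ∀ {n} → 0 < n → 0 < s₂ n
s₂>0 0<n = n≢0⇒n>0 λ eq → contradiction (s₂≡0⇒≡0 eq) (n>0⇒n≢0 0<n)

s₂-2^* : ∀ j m → s₂ (2 ^ j * m) ≡ s₂ m
s₂-2^* zero    m = cong s₂ (*-identityˡ m)
s₂-2^* (suc j) m = begin
  s₂ (2 ^ suc j * m)   ≡⟨ cong s₂ (*-assoc 2 (2 ^ j) m) ⟩
  s₂ (2 * (2 ^ j * m)) ≡⟨ s₂-even (2 ^ j * m) ⟩
  s₂ (2 ^ j * m)       ≡⟨ s₂-2^* j m ⟩
  s₂ m                 ∎
  where open ≡-Reasoning

-- The summand `2 ^ L * b` has no bits below position `L`, so nothing is carried. The induction on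
-- `L` strips the lowest bit of `a`.
s₂-concat : ∀ L {a} b → a < 2 ^ L → s₂ (a + 2 ^ L * b) ≡ s₂ a + s₂ b
s₂-concat zero    {zero} b _   = cong s₂ (*-identityˡ b)
s₂-concat zero    {suc a} b (s≤s ())
s₂-concat (suc L) {a} b = go (binary a)
  where
  open ≡-Reasoning
  go : ∀ {a} → Binary a → a < 2 ^ suc L → s₂ (a + 2 ^ suc L * b) ≡ s₂ a + s₂ b
  go 0ᵇ _ = s₂-2^* (suc L) b
  go (double {m} _) a< = begin
    s₂ (2 * m + 2 ^ suc L * b)    ≡⟨ cong s₂ (rearrange m (2 ^ L) b) ⟩
    s₂ (2 * (m + 2 ^ L * b))      ≡⟨ s₂-even (m + 2 ^ L * b) ⟩
    s₂ (m + 2 ^ L * b)            ≡⟨ s₂-concat L b (*-cancelˡ-< 2 m (2 ^ L) a<) ⟩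
    s₂ m + s₂ b                   ≡⟨ cong (_+ s₂ b) (s₂-even m) ⟨
    s₂ (2 * m) + s₂ b             ∎
    where
    rearrange : ∀ m P b → 2 * m + 2 * P * b ≡ 2 * (m + P * b)
    rearrange = solve-∀
  go (1+2×_ {m} _) a< = begin
    s₂ (1 + 2 * m + 2 ^ suc L * b)  ≡⟨ cong s₂ (rearrange m (2 ^ L) b) ⟩
    s₂ (1 + 2 * (m + 2 ^ L * b))    ≡⟨ s₂-odd (m + 2 ^ L * b) ⟩
    1 + s₂ (m + 2 ^ L * b)          ≡⟨ cong suc (s₂-concat L b (*-cancelˡ-< 2 m (2 ^ L) (<-trans (n<1+n _) a<))) ⟩
    1 + s₂ m + s₂ b                 ≡⟨ cong (_+ s₂ b) (s₂-odd m) ⟨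
    s₂ (1 + 2 * m) + s₂ b           ∎
    where
    rearrange : ∀ m P b → 1 + 2 * m + 2 * P * b ≡ 1 + 2 * (m + P * b)
    rearrange = solve-∀

s₂-≥-low-bits : ∀ L .{{_ : NonZero (2 ^ L)}} x → s₂ (x % 2 ^ L) ≤ s₂ x
s₂-≥-low-bits L x = begin
  s₂ (x % 2 ^ L)                              ≤⟨ m≤m+n _ _ ⟩
  s₂ (x % 2 ^ L) + s₂ (x / 2 ^ L)             ≡⟨ s₂-concat L (x / 2 ^ L) (m%n<n x (2 ^ L)) ⟨
  s₂ (x % 2 ^ L + 2 ^ L * (x / 2 ^ L))        ≡⟨ cong (λ y → s₂ (x % 2 ^ L + y)) (*-comm (2 ^ L) (x / 2 ^ L)) ⟩
  s₂ (x % 2 ^ L + x / 2 ^ L * 2 ^ L)          ≡⟨ cong s₂ (m≡m%n+[m/n]*n x (2 ^ L)) ⟨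
  s₂ x                                        ∎
  where open ≤-Reasoning

odd-part : ∀ {n} → 0 < n → ∃₂ λ j m → n ≡ 2 ^ j * (1 + 2 * m)
odd-part {n} = go (binary n)
  where
  go : ∀ {n} → Binary n → 0 < n → ∃₂ λ j m → n ≡ 2 ^ j * (1 + 2 * m)
  go (double {zero} b) ()
  go (double {m@(suc _)} b) _ with go b z<s
  ... | j , m′ , eq = suc j , m′ , trans (cong (2 *_) eq) (sym (*-assoc 2 (2 ^ j) (1 + 2 * m′)))
  go (1+2×_ {m} b) _ = 0 , m , sym (*-identityˡ _)

positive : ∀ {n k} → s₂ n ≡ suc k → 0 < n
positive {zero}  ()
positive {suc _} _ = z<s

s₂≡1 : ∀ {n} → s₂ n ≡ 1 → ∃ λ j → n ≡ 2 ^ j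
s₂≡1 {n} eq with odd-part (positive {n} eq)
... | j , m , refl = j , (begin
  2 ^ j * (1 + 2 * m) ≡⟨ cong (λ m → 2 ^ j * (1 + 2 * m)) (s₂≡0⇒≡0 {m} s₂m≡0) ⟩
  2 ^ j * 1           ≡⟨ *-identityʳ (2 ^ j) ⟩
  2 ^ j               ∎)
  where
  open ≡-Reasoning
  s₂m≡0 : s₂ m ≡ 0
  s₂m≡0 = suc-injective (trans (sym (s₂-odd m)) (trans (sym (s₂-2^* j (1 + 2 * m))) eq))

odd-s₂≡1 : ∀ m → s₂ (1 + 2 * m) ≡ 1 → m ≡ 0
odd-s₂≡1 m eq = s₂≡0⇒≡0 (suc-injective (trans (sym (s₂-odd m)) eq))

odd-s₂≡2 : ∀ m → s₂ (1 + 2 * m) ≡ 2 → ∃ λ j → m ≡ 2 ^ j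
odd-s₂≡2 m eq = s₂≡1 (suc-injective (trans (sym (s₂-odd m)) eq))

odd-s₂≡3 : ∀ m → s₂ (1 + 2 * m) ≡ 3 → ∃₂ λ i j → m ≡ 2 ^ i * (1 + 2 * 2 ^ j)
odd-s₂≡3 m eq = split (suc-injective (trans (sym (s₂-odd m)) eq))
  where
  split : s₂ m ≡ 2 → ∃₂ λ i j → m ≡ 2 ^ i * (1 + 2 * 2 ^ j)
  split eq with odd-part (positive {m} eq)
  ... | i , m′ , refl with odd-s₂≡2 m′ (trans (sym (s₂-2^* i (1 + 2 * m′))) eq)
  ... | j , refl = i , j , refl

-- Digit sums of products of two integers

odd*odd : ∀ m n → (1 + 2 * m) * (1 + 2 * n) ≡ 1 + 2 * (m + n + 2 * (m * n))
odd*odd = solve-∀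

odd-square : ∀ z → (1 + 2 * z) * (1 + 2 * z) ≡ 1 + 2 * (2 * (z * suc z))
odd-square = solve-∀

-- The only odd number with digit sum 1 is 1, so both odd factors must be 1.
odd-product-s₂≡1 : ∀ m n → s₂ ((1 + 2 * m) * (1 + 2 * n)) ≡ 1 → m ≡ 0 × n ≡ 0
odd-product-s₂≡1 m n eq = m+n≡0⇒m≡0 m m+n≡0 , m+n≡0⇒n≡0 m m+n≡0
  where
  m+n≡0 : m + n ≡ 0
  m+n≡0 = m+n≡0⇒m≡0 (m + n)
    (odd-s₂≡1 (m + n + 2 * (m * n)) (trans (cong s₂ (sym (odd*odd m n))) eq))

s₂-odd-parts : ∀ i j x y → s₂ ((2 ^ i * x) * (2 ^ j * y)) ≡ s₂ (x * y)
s₂-odd-parts i j x y = begin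
  s₂ ((2 ^ i * x) * (2 ^ j * y)) ≡⟨ cong s₂ ([m*n]*[o*p]≡[m*o]*[n*p] (2 ^ i) x (2 ^ j) y) ⟩
  s₂ ((2 ^ i * 2 ^ j) * (x * y)) ≡⟨ cong (λ p → s₂ (p * (x * y))) (^-distribˡ-+-* 2 i j) ⟨
  s₂ (2 ^ (i + j) * (x * y))     ≡⟨ s₂-2^* (i + j) (x * y) ⟩
  s₂ (x * y)                     ∎
  where open ≡-Reasoning

s₂-product>0 : ∀ {x y} → 0 < x → 0 < y → 0 < s₂ (x * y)
s₂-product>0 {suc x} {suc y} _ _ = s₂>0 {suc x * suc y} z<s

-- All divisors of a power of two are powers of two, and `x` is not one.
s₂-product≥2 : ∀ {x y} → 2 ≤ s₂ x → 0 < y → 2 ≤ s₂ (x * y)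
s₂-product≥2 {zero} ()
s₂-product≥2 {suc x} {y} 2≤ 0<y with s₂ (suc x * y) in eq | s₂-product>0 {suc x} z<s 0<y
... | suc (suc _) | _ = s≤s (s≤s z≤n)
... | 1           | _ with odd-part {suc x} z<s | odd-part 0<y
...   | i , m , x≡ | j , n , refl = contradiction 2≤ (≤⇒≯ (≤-reflexive (begin
  s₂ (suc x)               ≡⟨ cong s₂ x≡ ⟩
  s₂ (2 ^ i * (1 + 2 * m)) ≡⟨ s₂-2^* i (1 + 2 * m) ⟩
  s₂ (1 + 2 * m)           ≡⟨ cong (λ m → s₂ (1 + 2 * m)) m≡0 ⟩
  1                        ∎)))
  where
  open ≡-Reasoning
  m≡0 : m ≡ 0
  m≡0 = proj₁ (odd-product-s₂≡1 m n (trans (sym (s₂-odd-parts i j (1 + 2 * m) (1 + 2 * n)))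
          (trans (cong (λ x → s₂ (x * (2 ^ j * (1 + 2 * n)))) (sym x≡)) eq)))

s₂-product-unit : ∀ {x} y → s₂ x ≡ 1 → s₂ (x * y) ≡ s₂ y
s₂-product-unit {x} y eq with s₂≡1 {x} eq
... | j , refl = s₂-2^* j y

-- Since (1 + 2z)² = 1 + 4z(z + 1), the product z(z + 1) is a power of two. Its odd factor is then
-- 1, which leaves only z = 1.
odd-square-s₂≡2 : ∀ z → s₂ ((1 + 2 * z) * (1 + 2 * z)) ≡ 2 → z ≡ 1
odd-square-s₂≡2 z eq = go (binary z) s₂-pronic
  where
  s₂-pronic : s₂ (z * suc z) ≡ 1
  s₂-pronic = suc-injective (begin
    1 + s₂ (z * suc z)                   ≡⟨ cong suc (s₂-even (z * suc z)) ⟨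
    1 + s₂ (2 * (z * suc z))             ≡⟨ s₂-odd (2 * (z * suc z)) ⟨
    s₂ (1 + 2 * (2 * (z * suc z)))       ≡⟨ cong s₂ (odd-square z) ⟨
    s₂ ((1 + 2 * z) * (1 + 2 * z))       ≡⟨ eq ⟩
    2                                    ∎)
    where open ≡-Reasoning
  factor : ∀ {m y} → 0 < y → s₂ ((1 + 2 * m) * y) ≡ 1 → m ≡ 0
  factor {m} {y} 0<y eq with m
  ... | zero   = refl
  ... | suc m′ = contradiction
    (s₂-product≥2 {1 + 2 * suc m′} {y} (subst (2 ≤_) (sym (s₂-odd (suc m′))) (s≤s (s₂>0 {suc m′} z<s))) 0<y)
    (<⇒≱ (s≤s (≤-reflexive eq)))
  go : ∀ {z} → Binary z → s₂ (z * suc z) ≡ 1 → z ≡ 1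
  go 0ᵇ ()
  go (double {zero} _) ()
  go (double {m@(suc _)} _) eq =
    contradiction (factor {m} {2 * m} z<s (trans (cong s₂ (*-comm (1 + 2 * m) (2 * m))) eq)) λ ()
  go (1+2×_ {m} _) eq = cong (λ m → 1 + 2 * m) (factor {m} {2 + 2 * m} z<s eq)

-- Up to powers of two, a square of digit sum 1 or 2 comes from x = 1 or x = 3, and these have digit
-- sum at most 2.
s₂-square≥3 : ∀ {x} → 3 ≤ s₂ x → 3 ≤ s₂ (x * x)
s₂-square≥3 {zero} ()
s₂-square≥3 {suc x} 3≤ with odd-part {suc x} z<s
... | j , z , eq = subst (3 ≤_) (sym (trans (cong₂ (λ x y → s₂ (x * y)) eq eq) (s₂-odd-parts j j _ _)))
                     (odd-case z (subst (3 ≤_) (trans (cong s₂ eq) (s₂-2^* j _)) 3≤))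
  where
  odd-case : ∀ z → 3 ≤ s₂ (1 + 2 * z) → 3 ≤ s₂ ((1 + 2 * z) * (1 + 2 * z))
  odd-case z 3≤ with s₂ ((1 + 2 * z) * (1 + 2 * z)) in eq
  ... | 0 = contradiction (s₂≡0⇒≡0 {(1 + 2 * z) * (1 + 2 * z)} eq) λ ()
  ... | 1 with refl ← proj₁ (odd-product-s₂≡1 z z eq) = contradiction 3≤ λ { (s≤s ()) }
  ... | 2 with refl ← odd-square-s₂≡2 z eq = contradiction 3≤ λ { (s≤s (s≤s ())) }
  ... | suc (suc (suc _)) = s≤s (s≤s (s≤s z≤n))

-- Odd squares with digit sum 3

2∣pronic : ∀ z → ∃ λ t → z * suc z ≡ 2 * t
2∣pronic z = go (binary z)
  where
  go : ∀ {z} → Binary z → ∃ λ t → z * suc z ≡ 2 * t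
  go 0ᵇ             = 0 , refl
  go (double {m} _) = m * suc (2 * m) , *-assoc 2 m _
  go (1+2×_ {m} _)  = (1 + 2 * m) * suc m , lemma m
    where
    lemma : ∀ m → (1 + 2 * m) * (2 + 2 * m) ≡ 2 * ((1 + 2 * m) * (1 + m))
    lemma = solve-∀

-- Odd squares are 1 modulo 8 because z(z + 1) is even. This rules out the exponents 0 and 1 in the
-- shape given by `odd-s₂≡3`.
odd-square-s₂≡3 : ∀ z → s₂ ((1 + 2 * z) * (1 + 2 * z)) ≡ 3 →
  ∃₂ λ a b → (1 + 2 * z) * (1 + 2 * z) ≡ 1 + 8 * 2 ^ a * (1 + 2 * 2 ^ b)
odd-square-s₂≡3 z eq
  with odd-s₂≡3 (2 * (z * suc z)) (trans (cong s₂ (sym (odd-square z))) eq) | 2∣pronic z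
... | zero , b , eq′ | _ = contradiction (trans eq′ (*-identityˡ _)) (even≢odd (z * suc z) (2 ^ b))
... | 1 , b , eq′ | t , pr =
  contradiction (trans (sym pr) (*-cancelˡ-≡ _ _ 2 eq′)) (even≢odd t (2 ^ b))
... | suc (suc a) , b , eq′ | _ = a , b , trans (odd-square z) (trans (cong (λ y → 1 + 2 * y) eq′) (lemma (2 ^ a) (2 ^ b)))
  where
  lemma : ∀ A B → 1 + 2 * (2 * (2 * A) * (1 + 2 * B)) ≡ 1 + 8 * A * (1 + 2 * B)
  lemma = solve-∀

2^-factor : ∀ {a j} → a ≤ j → ∃ λ i → 2 ^ j ≡ 2 ^ a * 2 ^ i
2^-factor {a} {j} a≤j = j ∸ a , trans (cong (2 ^_) (sym (m+[n∸m]≡n a≤j))) (^-distribˡ-+-* 2 a (j ∸ a))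

-- Settles `{B, D} = {1, 2}` in `sparse-squares`, the only case with A = C that congruences modulo 4
-- leave open.
60A<64A : ∀ A J → 0 < A → 0 < J → 4 + 60 * A < 4 * J + 64 * A * J * J
60A<64A A@(suc _) J@(suc _) _ _ = +-mono-≤-< (*-monoʳ-≤ 4 {1} {J} (s≤s z≤n)) (begin-strict
  60 * A             <⟨ *-monoˡ-< A {60} {64} (toWitness {a? = 60 <? 64} _) ⟩
  64 * A             ≡⟨ trans (*-identityʳ (64 * A * 1)) (*-identityʳ (64 * A)) ⟨
  64 * A * 1 * 1     ≤⟨ *-mono-≤ (*-monoʳ-≤ (64 * A) {1} {J} (s≤s z≤n)) (s≤s z≤n) ⟩
  64 * A * J * J     ∎)
  where open ≤-Reasoning

-- x² = 1 + 8A(1 + 2B), y² = 1 + 8C(1 + 2D) and xy = 1 + 2J with A, B, C, D, J powers of two and A ≤ C: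
-- comparing sizes gives 16A ∣ J, and (xy)² = x²y² divided by 8A fails by parity, or by size if {B, D} = {1, 2}.
sparse-squares : ∀ {a b c d j} → a ≤ c →
  (1 + 8 * 2 ^ a * (1 + 2 * 2 ^ b)) * (1 + 8 * 2 ^ c * (1 + 2 * 2 ^ d)) ≢ (1 + 2 * 2 ^ j) * (1 + 2 * 2 ^ j)
sparse-squares {a} {b} {c} {d} {j} a≤c eq with 4 + a ≤? j
-- J and 16A are powers of two, so J < 16A means J ≤ 8A. Then xy ≤ 1 + 16A, whereas x² and y² are
-- both at least 1 + 24A.
... | no j≱ = <-irrefl (sym eq) (begin-strict
  (1 + 2 * 2 ^ j) * (1 + 2 * 2 ^ j)     ≤⟨ *-mono-≤ J≤ J≤ ⟩
  (1 + 16 * A) * (1 + 16 * A)           <⟨ *-mono-< (s≤s lt) (s≤s lt) ⟩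
  (1 + 8 * A * 3) * (1 + 8 * A * 3)     ≤⟨ *-mono-≤ (s≤s (*-monoʳ-≤ (8 * A) (three b)))
                                            (s≤s (*-mono-≤ (*-monoʳ-≤ 8 (^-monoʳ-≤ 2 a≤c)) (three d))) ⟩
  (1 + 8 * 2 ^ a * (1 + 2 * 2 ^ b)) * (1 + 8 * 2 ^ c * (1 + 2 * 2 ^ d)) ∎)
  where
  open ≤-Reasoning
  A : ℕ
  A = 2 ^ a
  three : ∀ b → 3 ≤ 1 + 2 * 2 ^ b
  three b = s≤s (*-monoʳ-≤ 2 (m^n>0 2 b))
  lt : 16 * A < 8 * A * 3
  lt = begin-strict
    16 * A         <⟨ m<m+n (16 * A) (*-mono-≤ {1} {8} (s≤s z≤n) (m^n>0 2 a)) ⟩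
    16 * A + 8 * A ≡⟨ lemma A ⟩
    8 * A * 3      ∎
    where
    lemma : ∀ A → 16 * A + 8 * A ≡ 8 * A * 3
    lemma = solve-∀
  J≤ : 1 + 2 * 2 ^ j ≤ 1 + 16 * A
  J≤ = s≤s (≤-trans (*-monoʳ-≤ 2 (^-monoʳ-≤ 2 (≤-pred (≰⇒> j≱)))) (≤-reflexive (lemma A)))
    where
    lemma : ∀ A → 2 * (2 * (2 * (2 * A))) ≡ 16 * A
    lemma = solve-∀
... | yes j≥ with 2^-factor j≥ | m≤n⇒m<n∨m≡n a≤c
-- Now C = 2AK. After subtracting 1 and dividing by 8A, x²y² becomes odd and (xy)² even.
...   | i , J≡ | inj₁ a<c with 2^-factor a<c
...     | k , C≡ = even≢odd (4 * J + 64 * A * J * J) (B + K * (1 + 2 * D) + 8 * A * K * (1 + 2 * B) * (1 + 2 * D)) (sym (*-cancelˡ-≡ _ _ (8 * 2 ^ a) {{m*n≢0 8 (2 ^ a) {{_}} {{m^n≢0 2 a}}}}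
          (+-cancelˡ-≡ 1 _ _ (begin
  1 + 8 * A * (1 + 2 * (B + K * (1 + 2 * D) + 8 * A * K * (1 + 2 * B) * (1 + 2 * D))) ≡⟨ lhs A B K D ⟩
  (1 + 8 * A * (1 + 2 * B)) * (1 + 8 * (2 * A * K) * (1 + 2 * D)) ≡⟨ cong (λ C → (1 + 8 * A * (1 + 2 * B)) * (1 + 8 * C * (1 + 2 * D))) C≡ ⟨
  (1 + 8 * A * (1 + 2 * B)) * (1 + 8 * 2 ^ c * (1 + 2 * D)) ≡⟨ eq ⟩
  (1 + 2 * 2 ^ j) * (1 + 2 * 2 ^ j)                         ≡⟨ cong (λ J → (1 + 2 * J) * (1 + 2 * J)) J≡ ⟩
  (1 + 2 * (2 ^ (4 + a) * J)) * (1 + 2 * (2 ^ (4 + a) * J)) ≡⟨ rhs A J ⟩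
  1 + 8 * A * (2 * (4 * J + 64 * A * J * J))                ∎))))
  where
  open ≡-Reasoning
  A = 2 ^ a
  B = 2 ^ b
  D = 2 ^ d
  J = 2 ^ i
  K = 2 ^ k
  lhs : ∀ A B K D → 1 + 8 * A * (1 + 2 * (B + K * (1 + 2 * D) + 8 * A * K * (1 + 2 * B) * (1 + 2 * D)))
        ≡ (1 + 8 * A * (1 + 2 * B)) * (1 + 8 * (2 * A * K) * (1 + 2 * D))
  lhs = solve-∀
  rhs : ∀ A J → (1 + 2 * (2 * (2 * (2 * (2 * A))) * J)) * (1 + 2 * (2 * (2 * (2 * (2 * A))) * J))
        ≡ 1 + 8 * A * (2 * (4 * J + 64 * A * J * J))
  rhs = solve-∀
sparse-squares {a} {b} {.a} {d} {j} a≤c eq | yes j≥ | i , J≡ | inj₂ refl =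
  residues b d (*-cancelˡ-≡ _ _ (16 * 2 ^ a) {{m*n≢0 16 (2 ^ a) {{_}} {{m^n≢0 2 a}}}}
    (+-cancelˡ-≡ 1 _ _ (begin
  1 + 16 * A * (1 + B + D + 4 * A * (1 + 2 * B) * (1 + 2 * D))  ≡⟨ lhs A B D ⟩
  (1 + 8 * A * (1 + 2 * B)) * (1 + 8 * A * (1 + 2 * D))         ≡⟨ eq ⟩
  (1 + 2 * 2 ^ j) * (1 + 2 * 2 ^ j)                             ≡⟨ cong (λ J → (1 + 2 * J) * (1 + 2 * J)) J≡ ⟩
  (1 + 2 * (2 ^ (4 + a) * J)) * (1 + 2 * (2 ^ (4 + a) * J))     ≡⟨ rhs A J ⟩
  1 + 16 * A * (4 * J + 64 * A * J * J)                         ∎)))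
  where
  open ≡-Reasoning
  A = 2 ^ a
  B = 2 ^ b
  D = 2 ^ d
  J = 2 ^ i
  lhs : ∀ A B D → 1 + 16 * A * (1 + B + D + 4 * A * (1 + 2 * B) * (1 + 2 * D))
        ≡ (1 + 8 * A * (1 + 2 * B)) * (1 + 8 * A * (1 + 2 * D))
  lhs = solve-∀
  rhs : ∀ A J → (1 + 2 * (2 * (2 * (2 * (2 * A))) * J)) * (1 + 2 * (2 * (2 * (2 * (2 * A))) * J))
        ≡ 1 + 16 * A * (4 * J + 64 * A * J * J)
  rhs = solve-∀
  even-rhs : ∀ A J → 4 * J + 64 * A * J * J ≡ 2 * (2 * (J + 16 * A * J * J))
  even-rhs = solve-∀
  R = J + 16 * A * J * J
  -- The right-hand side is a multiple of 4. The left-hand side is odd, or 2 modulo 4, except for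
  -- `{B, D} = {1, 2}`, where it equals 4 + 60A and is too small.
  residues : ∀ b d → 1 + 2 ^ b + 2 ^ d + 4 * A * (1 + 2 * 2 ^ b) * (1 + 2 * 2 ^ d) ≢ 4 * J + 64 * A * J * J
  residues zero zero eq = even≢odd (2 * R) (1 + 18 * A) (sym (trans (lemma A) (trans eq (even-rhs A J))))
    where
    lemma : ∀ A → 1 + 2 * (1 + 18 * A) ≡ 3 + 4 * A * 3 * 3
    lemma = solve-∀
  residues zero 1 eq = <-irrefl (trans (lemma A) eq) (60A<64A A J (m^n>0 2 a) (m^n>0 2 i))
    where
    lemma : ∀ A → 4 + 60 * A ≡ 4 + 4 * A * 3 * 5
    lemma = solve-∀
  residues 1 zero eq = <-irrefl (trans (lemma A) eq) (60A<64A A J (m^n>0 2 a) (m^n>0 2 i))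
    where
    lemma : ∀ A → 4 + 60 * A ≡ 4 + 4 * A * 5 * 3
    lemma = solve-∀
  residues zero (suc (suc d)) eq = even≢odd R (2 ^ d + 3 * A * (1 + 8 * 2 ^ d)) (sym (*-cancelˡ-≡ _ _ 2 (trans (lemma A (2 ^ d)) (trans eq (even-rhs A J)))))
    where
    lemma : ∀ A D → 2 * (1 + 2 * (D + 3 * A * (1 + 8 * D)))
            ≡ 2 + 2 * (2 * D) + 4 * A * 3 * (1 + 2 * (2 * (2 * D)))
    lemma = solve-∀
  residues (suc (suc b)) zero eq = even≢odd R (2 ^ b + 3 * A * (1 + 8 * 2 ^ b)) (sym (*-cancelˡ-≡ _ _ 2 (trans (lemma A (2 ^ b)) (trans eq (even-rhs A J)))))
    where
    lemma : ∀ A B → 2 * (1 + 2 * (B + 3 * A * (1 + 8 * B)))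
            ≡ 1 + 2 * (2 * B) + 1 + 4 * A * (1 + 2 * (2 * (2 * B))) * 3
    lemma = solve-∀
  residues (suc b) (suc d) eq = even≢odd (2 * R) (2 ^ b + 2 ^ d + 2 * A * (1 + 4 * 2 ^ b) * (1 + 4 * 2 ^ d)) (sym (trans (lemma A (2 ^ b) (2 ^ d)) (trans eq (even-rhs A J))))
    where
    lemma : ∀ A B D → 1 + 2 * (B + D + 2 * A * (1 + 4 * B) * (1 + 4 * D))
            ≡ 1 + 2 * B + 2 * D + 4 * A * (1 + 2 * (2 * B)) * (1 + 2 * (2 * D))
    lemma = solve-∀

-- The three digit sums fix the shapes of x², y² and xy, and x²y² = (xy)² is then the equation
-- excluded by `sparse-squares`. By symmetry the smaller exponent may come first.
not-3-2-3 : ∀ m n → s₂ ((1 + 2 * m) * (1 + 2 * m)) ≡ 3 → s₂ ((1 + 2 * m) * (1 + 2 * n)) ≡ 2 →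
            s₂ ((1 + 2 * n) * (1 + 2 * n)) ≢ 3
not-3-2-3 m n α β γ with odd-square-s₂≡3 m α | odd-square-s₂≡3 n γ
  | odd-s₂≡2 (m + n + 2 * (m * n)) (trans (cong s₂ (sym (odd*odd m n))) β)
... | a , b , x² | c , d , y² | j , xy = by-order (≤-total a c)
  where
  open ≡-Reasoning
  square-of-product : (1 + 8 * 2 ^ a * (1 + 2 * 2 ^ b)) * (1 + 8 * 2 ^ c * (1 + 2 * 2 ^ d))
                      ≡ (1 + 2 * 2 ^ j) * (1 + 2 * 2 ^ j)
  square-of-product = begin
    (1 + 8 * 2 ^ a * (1 + 2 * 2 ^ b)) * (1 + 8 * 2 ^ c * (1 + 2 * 2 ^ d)) ≡⟨ cong₂ _*_ x² y² ⟨
    ((1 + 2 * m) * (1 + 2 * m)) * ((1 + 2 * n) * (1 + 2 * n))             ≡⟨ [m*n]*[o*p]≡[m*o]*[n*p] (1 + 2 * m) (1 + 2 * m) (1 + 2 * n) (1 + 2 * n) ⟩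
    ((1 + 2 * m) * (1 + 2 * n)) * ((1 + 2 * m) * (1 + 2 * n))             ≡⟨ cong (λ p → p * p) (trans (odd*odd m n) (cong (λ h → 1 + 2 * h) xy)) ⟩
    (1 + 2 * 2 ^ j) * (1 + 2 * 2 ^ j) ∎
  by-order : a ≤ c ⊎ c ≤ a → ⊥
  by-order (inj₁ a≤c) = sparse-squares {a} {b} {c} {d} {j} a≤c square-of-product
  by-order (inj₂ c≤a) = sparse-squares {c} {d} {a} {b} {j} c≤a
    (trans (*-comm (1 + 8 * 2 ^ c * (1 + 2 * 2 ^ d)) _) square-of-product)

-- Odd numbers multiplied by 3

*3-odd : ∀ m → (1 + 2 * m) * 3 ≡ 1 + 2 * (1 + 3 * m)
*3-odd = solve-∀

-- With fuel `f` only the lowest `f` digits are counted, so a small fixed fuel gives a lower bound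
-- that is cheap to evaluate.
s₂-aux≤s₂ : ∀ f m → s₂-aux f m ≤ s₂ m
s₂-aux≤s₂ zero    m = z≤n
s₂-aux≤s₂ (suc f) m = subst (s₂-aux (suc f) m ≤_) (sym (s₂-rec m)) (+-monoʳ-≤ (m % 2) (s₂-aux≤s₂ f (m / 2)))

low-bits≤s₂ : ∀ f L .{{_ : NonZero (2 ^ L)}} {x r} → x % 2 ^ L ≡ r → s₂-aux f r ≤ s₂ x
low-bits≤s₂ f L {x} refl = ≤-trans (s₂-aux≤s₂ f (x % 2 ^ L)) (s₂-≥-low-bits L x)

-- A finite check by evaluation. The division is exact only for even `j`, but the claim also holds
-- for the rounded quotients. Since x ≤ 683, fuel 20 reaches all digits of x².
thirds : ∀ {j} → j < 11 →
  let x = (1 + 2 * 2 ^ j) / 3 in s₂ x ≤ 4 ⊎ 5 ≤ s₂-aux 20 (x * x)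
thirds = toWitness {a? = allUpTo? (λ j → let x = (1 + 2 * 2 ^ j) / 3 in
  (s₂ x ≤? 4) ⊎-dec (5 ≤? s₂-aux 20 (x * x))) 11} _

-- Both `c` and `x` are inverses of 3 modulo `n`.
third-mod : ∀ n c x k .{{_ : NonZero n}} → c * 3 ≡ 1 + 2 * n → x * 3 ≡ 1 + n * k → x % n ≡ c % n
third-mod n c x k c*3≡ x*3≡ = begin
  x % n                     ≡⟨ [m+kn]%n≡m%n x (2 * x) n ⟨
  (x + 2 * x * n) % n       ≡⟨ cong (_% n) (lemma x n) ⟩
  (x * (1 + 2 * n)) % n     ≡⟨ cong (λ y → x * y % n) c*3≡ ⟨
  (x * (c * 3)) % n         ≡⟨ cong (_% n) (lemma′ x c) ⟩
  (c * (x * 3)) % n         ≡⟨ cong (λ y → c * y % n) x*3≡ ⟩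
  (c * (1 + n * k)) % n     ≡⟨ cong (_% n) (lemma″ c n k) ⟩
  (c + c * k * n) % n       ≡⟨ [m+kn]%n≡m%n c (c * k) n ⟩
  c % n                     ∎
  where
  open ≡-Reasoning
  lemma : ∀ x n → x + 2 * x * n ≡ x * (1 + 2 * n)
  lemma = solve-∀
  lemma′ : ∀ x c → x * (c * 3) ≡ c * (x * 3)
  lemma′ = solve-∀
  lemma″ : ∀ c n k → c * (1 + n * k) ≡ c + c * k * n
  lemma″ = solve-∀

-- The cases `j` < 11 are in `thirds`. For larger `j` the number 2 · 2ʲ is divisible by 2¹², so `x`
-- is inverse to 3 modulo 2¹² and its low bits alone contradict `s₂ x ≤ 6`.
third-of-1+2^ : ∀ x j → x * 3 ≡ 1 + 2 * 2 ^ j → s₂ x ≤ 6 → 5 ≤ s₂ x → 5 ≤ s₂ (x * x)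
third-of-1+2^ x j 3x≡ ≤6 5≤ = go (j <? 11)
  where
  go : _ → 5 ≤ s₂ (x * x)
  go (yes j<11) with subst (λ x → s₂ x ≤ 4 ⊎ 5 ≤ s₂-aux 20 (x * x))
                       (trans (cong (_/ 3) (sym 3x≡)) (m*n/n≡m x 3)) (thirds j<11)
  ... | inj₁ ≤4 = contradiction (≤-trans 5≤ ≤4) (<⇒≱ ≤-refl)
  ... | inj₂ ge = ≤-trans ge (s₂-aux≤s₂ 20 (x * x))
  -- 2731 is the inverse of 3 modulo 2¹², with 7 binary digits 1.
  go (no j≮11) = contradiction (≤-trans (low-bits≤s₂ 12 12 {x} low) ≤6) (<⇒≱ ≤-refl)
    where
    i : ℕ
    i = proj₁ (2^-factor {12} {suc j} (s≤s (≮⇒≥ j≮11)))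
    low : x % 2 ^ 12 ≡ 2731
    low = third-mod (2 ^ 12) 2731 x (2 ^ i) refl
      (trans 3x≡ (cong suc (proj₂ (2^-factor {12} {suc j} (s≤s (≮⇒≥ j≮11))))))

triple-s₂≡2 : ∀ m → s₂ ((1 + 2 * m) * 3) ≡ 2 → s₂ (1 + 2 * m) ≤ 6 → 5 ≤ s₂ (1 + 2 * m) →
  5 ≤ s₂ ((1 + 2 * m) * (1 + 2 * m))
triple-s₂≡2 m eq with odd-s₂≡2 (1 + 3 * m) (trans (cong s₂ (sym (*3-odd m))) eq)
... | j , h≡ = third-of-1+2^ (1 + 2 * m) j (trans (*3-odd m) (cong (λ h → 1 + 2 * h) h≡))

3∤2^ : ∀ j x → x * 3 ≢ 2 ^ j
3∤2^ zero    zero    ()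
3∤2^ zero    (suc x) ()
3∤2^ (suc j) x eq with binary x
... | 0ᵇ = contradiction eq (<⇒≢ (m^n>0 2 (suc j)))
... | double {m} _ = 3∤2^ j m (*-cancelˡ-≡ _ _ 2 (trans (sym (*-assoc 2 m 3)) eq))
... | 1+2×_ {m} _  = even≢odd (2 ^ j) (1 + 3 * m) (trans (sym eq) (*3-odd m))

3∤c*3+2^ : ∀ c j x → x * 3 ≢ c * 3 + 2 ^ j
3∤c*3+2^ zero    j x       = 3∤2^ j x
3∤c*3+2^ (suc c) j zero    ()
3∤c*3+2^ (suc c) j (suc x) = 3∤c*3+2^ c j x ∘ +-cancelˡ-≡ 3 _ _

*3≢ : ∀ x {n} → n % 3 ≢ 0 → x * 3 ≢ n
*3≢ x n%3≢0 eq = n%3≢0 (trans (cong (_% 3) (sym eq)) (m*n%n≡0 x 3))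

square-injective : ∀ {x y} → x * x ≡ y * y → x ≡ y
square-injective {x} {y} eq with <-cmp x y
... | tri< x<y _ _ = contradiction eq (<⇒≢ (*-mono-< x<y x<y))
... | tri≈ _ x≡y _ = x≡y
... | tri> _ _ y<x = contradiction (sym eq) (<⇒≢ (*-mono-< y<x y<x))

-- Comparing x² = 1 + 8A(1 + 2B) with (3x)² modulo small powers of two leaves only x = 5, 7, 23.
square-triple-s₂≡3 : ∀ m → s₂ ((1 + 2 * m) * (1 + 2 * m)) ≡ 3 → s₂ ((1 + 2 * m) * 3) ≡ 3 →
  s₂ (1 + 2 * m) ≤ 4
square-triple-s₂≡3 m α β with odd-square-s₂≡3 m α
  | odd-s₂≡3 (1 + 3 * m) (trans (cong s₂ (sym (*3-odd m))) β)
... | a , b , x² | i , j , h≡ = go i (trans (*3-odd m) (cong (λ h → 1 + 2 * h) h≡))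
  where
  x = 1 + 2 * m
  squared : ∀ {t} → x * 3 ≡ t → 9 * (1 + 8 * 2 ^ a * (1 + 2 * 2 ^ b)) ≡ t * t
  squared {t} 3x≡ = trans (cong (9 *_) (sym x²)) (trans (lemma x) (cong (λ t → t * t) 3x≡))
    where
    lemma : ∀ x → 9 * (x * x) ≡ (x * 3) * (x * 3)
    lemma = solve-∀
  small : ∀ y → {s≤4 : s₂ y ≤ 4} → x * 3 ≡ y * 3 → s₂ x ≤ 4
  small y {s≤4} 3x≡3y = subst (λ y → s₂ y ≤ 4) (sym (*-cancelʳ-≡ x y 3 3x≡3y)) s≤4

  -- Here 3x = 5 + 128W. Reduction modulo 16 excludes A = 1, and modulo 32 it excludes A ≥ 4. For A
  -- = 2 there remains 4 + 9B = 8Z, which modulo 8 forces B = 4, hence Z = 5, but Z > 5.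
  large-V : ∀ a b W → 0 < W → 9 * (1 + 8 * 2 ^ a * (1 + 2 * 2 ^ b)) ≢ (5 + 8 * (16 * W)) * (5 + 8 * (16 * W))
  large-V zero b W _ eq = even≢odd (1 + 80 * W + 1024 * W * W) (4 + 9 * B)
    (*-cancelˡ-≡ _ _ 8 (+-cancelˡ-≡ 9 _ _ (trans (rhs W) (trans (sym eq) (lhs B)))))
    where
    B = 2 ^ b
    lhs : ∀ B → 9 * (1 + 8 * (1 + 2 * B)) ≡ 9 + 8 * (1 + 2 * (4 + 9 * B))
    lhs = solve-∀
    rhs : ∀ W → 9 + 8 * (2 * (1 + 80 * W + 1024 * W * W)) ≡ (5 + 8 * (16 * W)) * (5 + 8 * (16 * W))
    rhs = solve-∀
  large-V (suc (suc a)) b W _ eq = even≢odd (9 * A * (1 + 2 * B)) (40 * W + 512 * W * W)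
    (*-cancelˡ-≡ _ _ 16 (+-cancelˡ-≡ 9 _ _ (trans (lhs A B) (trans eq (rhs W)))))
    where
    A = 2 ^ a
    B = 2 ^ b
    lhs : ∀ A B → 9 + 16 * (2 * (9 * A * (1 + 2 * B))) ≡ 9 * (1 + 8 * (2 * (2 * A)) * (1 + 2 * B))
    lhs = solve-∀
    rhs : ∀ W → (5 + 8 * (16 * W)) * (5 + 8 * (16 * W)) ≡ 9 + 16 * (1 + 2 * (40 * W + 512 * W * W))
    rhs = solve-∀
  large-V 1 b W 0<W eq = byB b (*-cancelˡ-≡ _ _ 32 (+-cancelˡ-≡ 25 _ _ (trans (lhs (2 ^ b)) (trans eq (rhs W)))))
    where
    lhs : ∀ B → 25 + 32 * (4 + 9 * B) ≡ 9 * (1 + 8 * 2 * (1 + 2 * B))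
    lhs = solve-∀
    rhs : ∀ W → (5 + 8 * (16 * W)) * (5 + 8 * (16 * W)) ≡ 25 + 32 * (8 * (5 * W + 64 * W * W))
    rhs = solve-∀
    Z = 5 * W + 64 * W * W
    byB : ∀ b → 4 + 9 * 2 ^ b ≢ 8 * Z
    byB zero eq = even≢odd (4 * Z) 6 (trans (sym (*-assoc 2 4 Z)) (sym eq))
    byB 1    eq = even≢odd (2 * Z) 5 (*-cancelˡ-≡ _ _ 2 (trans (lemma Z) (sym eq)))
      where
      lemma : ∀ Z → 2 * (2 * (2 * Z)) ≡ 8 * Z
      lemma = solve-∀
    byB 2    eq = <-irrefl (*-cancelˡ-≡ 5 Z 8 eq) (lemma W 0<W)
      where
      lemma : ∀ W → 0 < W → 5 < 5 * W + 64 * W * W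
      lemma W@(suc _) _ = +-mono-≤-< (*-monoʳ-≤ 5 {1} {W} (s≤s z≤n)) z<s
    byB (suc (suc (suc b))) eq = even≢odd Z (9 * 2 ^ b) (*-cancelˡ-≡ _ _ 4 (trans (lemma Z) (trans (sym eq) (lemma′ (2 ^ b)))))
      where
      lemma : ∀ Z → 4 * (2 * Z) ≡ 8 * Z
      lemma = solve-∀
      lemma′ : ∀ B → 4 + 9 * (2 * (2 * (2 * B))) ≡ 4 * (1 + 2 * (9 * B))
      lemma′ = solve-∀

  -- With V = 2ʲ this is 3x = 5 + 8V. The values V = 1, 4 fail modulo 3, and V = 2, 8 give x = 7,
  -- 23.
  small-V : ∀ j → x * 3 ≡ 1 + 2 * (2 * (1 + 2 * 2 ^ j)) → s₂ x ≤ 4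
  small-V 0 eq = contradiction eq (*3≢ x λ ())
  small-V 1 eq = small 7 {s≤s (s≤s (s≤s z≤n))} eq
  small-V 2 eq = contradiction eq (*3≢ x λ ())
  small-V 3 eq = small 23 {≤-refl} eq
  small-V (suc (suc (suc (suc j)))) eq = contradiction (squared (trans eq (lemma (2 ^ j)))) (large-V a b (2 ^ j) (m^n>0 2 j))
    where
    lemma : ∀ W → 1 + 2 * (2 * (1 + 2 * (2 * (2 * (2 * (2 * W)))))) ≡ 5 + 8 * (16 * W)
    lemma = solve-∀

  -- Here 3x = 1 + 16Ut, so 9x² is 1 modulo 32. Reduction modulo 16 excludes even A, then modulo 32
  -- even B, and A = B = 1 gives x = 5.
  large-U : ∀ U t a b → x * x ≡ 1 + 8 * 2 ^ a * (1 + 2 * 2 ^ b) →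
            9 * (1 + 8 * 2 ^ a * (1 + 2 * 2 ^ b)) ≡ (1 + 2 * (8 * U * t)) * (1 + 2 * (8 * U * t)) → s₂ x ≤ 4
  large-U U t (suc a) b _ eq = contradiction
    (*-cancelˡ-≡ _ _ 8 (+-cancelˡ-≡ 1 _ _ (trans (rhs U t) (trans (sym eq) (lhs (2 ^ a) (2 ^ b))))))
    (even≢odd (2 * U * t + 16 * U * t * (U * t)) (9 * 2 ^ a * (1 + 2 * 2 ^ b)))
    where
    lhs : ∀ A B → 9 * (1 + 8 * (2 * A) * (1 + 2 * B)) ≡ 1 + 8 * (1 + 2 * (9 * A * (1 + 2 * B)))
    lhs = solve-∀
    rhs : ∀ U t → 1 + 8 * (2 * (2 * U * t + 16 * U * t * (U * t))) ≡ (1 + 2 * (8 * U * t)) * (1 + 2 * (8 * U * t))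
    rhs = solve-∀
  large-U U t zero (suc b) _ eq = contradiction
    (*-cancelˡ-≡ _ _ 16 (+-cancelˡ-≡ 1 _ _ (trans (rhs U t) (trans (sym eq) (lhs (2 ^ b))))))
    (even≢odd (U * t + 8 * U * t * (U * t)) (2 + 9 * 2 ^ b))
    where
    lhs : ∀ B → 9 * (1 + 8 * (1 + 2 * (2 * B))) ≡ 1 + 16 * (1 + 2 * (2 + 9 * B))
    lhs = solve-∀
    rhs : ∀ U t → 1 + 16 * (2 * (U * t + 8 * U * t * (U * t))) ≡ (1 + 2 * (8 * U * t)) * (1 + 2 * (8 * U * t))
    rhs = solve-∀
  large-U U t zero zero x²≡ _ = subst (λ y → s₂ y ≤ 4) (sym (square-injective {x} {5} x²≡)) (s≤s (s≤s z≤n))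

  -- For `i` = 0 and `i` = 2 the right-hand side is 3 + 4V or 9 + 16V, so 3 would divide a power of
  -- two.
  go : ∀ i → x * 3 ≡ 1 + 2 * (2 ^ i * (1 + 2 * 2 ^ j)) → s₂ x ≤ 4
  go 0 eq = contradiction (trans eq (lemma (2 ^ j))) (3∤c*3+2^ 1 (2 + j) x)
    where
    lemma : ∀ V → 1 + 2 * (1 * (1 + 2 * V)) ≡ 3 + 2 * (2 * V)
    lemma = solve-∀
  go 1 eq = small-V j eq
  go 2 eq = contradiction (trans eq (lemma (2 ^ j))) (3∤c*3+2^ 3 (4 + j) x)
    where
    lemma : ∀ V → 1 + 2 * (4 * (1 + 2 * V)) ≡ 9 + 2 * (2 * (2 * (2 * V)))
    lemma = solve-∀
  go (suc (suc (suc i))) eq = large-U (2 ^ i) (1 + 2 * 2 ^ j) a b x²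
    (squared (trans eq (cong (λ U → 1 + 2 * (U * (1 + 2 * 2 ^ j))) (lemma (2 ^ i)))))
    where
    lemma : ∀ U → 2 * (2 * (2 * U)) ≡ 8 * U
    lemma = solve-∀

-- Inequalities for pairs of coefficients

sum≤8⇒3-2-3 : ∀ {α β γ} → 3 ≤ α → 2 ≤ β → 3 ≤ γ → α + β + γ ≤ 8 → α ≡ 3 × β ≡ 2 × γ ≡ 3
sum≤8⇒3-2-3 {suc (suc (suc a))} {suc (suc b)} {suc (suc (suc c))}
  (s≤s (s≤s (s≤s _))) (s≤s (s≤s _)) (s≤s (s≤s (s≤s _))) le =
  cong (3 +_) (m+n≡0⇒m≡0 a a+b≡0) , cong (2 +_) (m+n≡0⇒n≡0 a a+b≡0) , cong (3 +_) (m+n≡0⇒n≡0 (a + b) sum≡0)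
  where
  lemma : ∀ a b c → 8 + (a + b + c) ≡ 3 + a + (2 + b) + (3 + c)
  lemma = solve-∀
  sum≡0 : a + b + c ≡ 0
  sum≡0 = n≤0⇒n≡0 (+-cancelˡ-≤ 8 _ 0 (≤-trans (≤-reflexive (lemma a b c)) le))
  a+b≡0 : a + b ≡ 0
  a+b≡0 = m+n≡0⇒m≡0 (a + b) sum≡0

-- The case s₂ (y²) = 2, which forces y = 3.
pair-with-3 : ∀ m → s₂ (1 + 2 * m) ≤ 6 →
  s₂ ((1 + 2 * m) * (1 + 2 * m)) + s₂ ((1 + 2 * m) * 3) ≤ s₂ (1 + 2 * m) →
  2 ≤ s₂ (1 + 2 * m) → ⊥
pair-with-3 m w≤6 α+β≤w 2≤w = go (s₂ ((1 + 2 * m) * 3)) refl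
  where
  x = 1 + 2 * m
  2≤α = s₂-product≥2 {x} {x} 2≤w z<s
  2≤β = s₂-product≥2 {x} {3} 2≤w z<s
  -- The assumption improves itself: w ≥ 4 gives α ≥ 3, which in turn gives w ≥ 5. As α + β ≤ 6,
  -- only β = 2 and α = β = 3 remain, and these are excluded by the results on multiples of 3.
  4≤w = ≤-trans (+-mono-≤ 2≤α 2≤β) α+β≤w
  3≤α = s₂-square≥3 {x} (≤-trans (s≤s (s≤s (s≤s z≤n))) 4≤w)
  5≤w = ≤-trans (+-mono-≤ 3≤α 2≤β) α+β≤w
  go : ∀ β → s₂ (x * 3) ≡ β → ⊥
  go 0 eq = contradiction (subst (2 ≤_) eq 2≤β) λ ()
  go 1 eq = contradiction (subst (2 ≤_) eq 2≤β) λ { (s≤s ()) }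
  go 2 eq = contradiction (≤-trans (+-mono-≤ (triple-s₂≡2 m eq w≤6 5≤w) 2≤β) (≤-trans α+β≤w w≤6)) (<⇒≱ ≤-refl)
  go 3 eq = contradiction (square-triple-s₂≡3 m α≡3 eq) (<⇒≱ 5≤w)
    where
    α≡3 : s₂ (x * x) ≡ 3
    α≡3 = ≤-antisym (+-cancelʳ-≤ 3 _ 3 (subst (λ β → s₂ (x * x) + β ≤ 6) eq (≤-trans α+β≤w w≤6))) 3≤α
  go (suc (suc (suc (suc b)))) eq = contradiction
    (≤-trans (+-mono-≤ 3≤α (≤-trans (s≤s (s≤s (s≤s (s≤s (z≤n {b}))))) (≤-reflexive (sym eq)))) (≤-trans α+β≤w w≤6)) (<⇒≱ ≤-refl)

-- By contradiction, according to the smaller digit sum `s₂ y`. If it is 1, multiplication by `y`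
-- preserves digit sums. If it is 2, either y = 3 or `s₂ (y * y)` is at least 3. In this last case
-- and for `s₂ y` ≥ 3, the lower bounds 3, 2, 3 are attained because the total is at most 8.
odd-pair : ∀ m n → let x = 1 + 2 * m; y = 1 + 2 * n in
  s₂ y ≤ s₂ x → s₂ x + s₂ y ≤ 8 → s₂ x + s₂ y < s₂ (x * x) + s₂ (x * y) + s₂ (y * y)
odd-pair m n y≤x x+y≤8 = ≰⇒> (λ le → go (s₂ y) refl le)
  where
  x = 1 + 2 * m
  y = 1 + 2 * n
  go : ∀ w → s₂ y ≡ w → ¬ (s₂ (x * x) + s₂ (x * y) + s₂ (y * y) ≤ s₂ x + s₂ y)
  go 0 eq _ = contradiction (s₂≡0⇒≡0 {y} eq) λ ()
  go 1 eq le = <⇒≱ (begin-strict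
    s₂ x + s₂ y                              ≡⟨ cong (s₂ x +_) eq ⟩
    s₂ x + 1                                 ≡⟨ cong (_+ 1) (s₂-product-unit {y} x eq) ⟨
    s₂ (y * x) + 1                           ≡⟨ cong (λ p → s₂ p + 1) (*-comm y x) ⟩
    s₂ (x * y) + 1                           <⟨ +-mono-<-≤ (m<n+m _ (s₂-product>0 {x} {x} z<s z<s)) (s₂-product>0 {y} {y} z<s z<s) ⟩
    s₂ (x * x) + s₂ (x * y) + s₂ (y * y)     ∎) le
    where open ≤-Reasoning
  go 2 eq le = by-γ (s₂ (y * y)) refl
    where
    2≤x = subst (_≤ s₂ x) eq y≤x
    x≤6 : s₂ x ≤ 6
    x≤6 = +-cancelʳ-≤ 2 _ 6 (subst (λ w → s₂ x + w ≤ 8) eq x+y≤8)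
    2≤γ = s₂-product≥2 {y} {y} (≤-reflexive (sym eq)) z<s
    2≤α = s₂-product≥2 {x} {x} 2≤x z<s
    2≤β = s₂-product≥2 {x} {y} 2≤x z<s
    by-γ : ∀ γ → s₂ (y * y) ≡ γ → ⊥
    by-γ 0 γ≡ = contradiction (subst (2 ≤_) γ≡ 2≤γ) λ ()
    by-γ 1 γ≡ = contradiction (subst (2 ≤_) γ≡ 2≤γ) λ { (s≤s ()) }
    by-γ 2 γ≡ = pair-with-3 m x≤6 (subst (λ y → s₂ (x * x) + s₂ (x * y) ≤ s₂ x) y≡3
                  (+-cancelʳ-≤ 2 _ _ (subst₂ (λ γ w → s₂ (x * x) + s₂ (x * y) + γ ≤ s₂ x + w) γ≡ eq le))) 2≤x
      where
      y≡3 : y ≡ 3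
      y≡3 = cong (λ n → 1 + 2 * n) (odd-square-s₂≡2 n γ≡)
    by-γ γ@(suc (suc (suc _))) γ≡ with sum≤8⇒3-2-3
           (s₂-square≥3 {x} (+-cancelʳ-≤ 2 3 _ (subst (λ w → 5 ≤ s₂ x + w) eq
             (≤-trans (m≤m+n 5 2) (≤-trans (+-mono-≤ (+-mono-≤ 2≤α 2≤β) 3≤γ) le)))))
           2≤β 3≤γ (≤-trans le x+y≤8)
      where
      3≤γ : 3 ≤ s₂ (y * y)
      3≤γ = subst (3 ≤_) (sym γ≡) (s≤s (s≤s (s≤s z≤n)))
    ... | α≡3 , β≡2 , γ≡3 = not-3-2-3 m n α≡3 β≡2 γ≡3
  go (suc (suc (suc w))) eq le with sum≤8⇒3-2-3
           (s₂-square≥3 {x} (≤-trans 3≤y y≤x)) (s₂-product≥2 {x} {y} (≤-trans (n≤1+n 2) (≤-trans 3≤y y≤x)) z<s)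
           (s₂-square≥3 {y} 3≤y) (≤-trans le x+y≤8)
    where
    3≤y : 3 ≤ s₂ y
    3≤y = subst (3 ≤_) (sym eq) (s≤s (s≤s (s≤s z≤n)))
  ... | α≡3 , β≡2 , γ≡3 = not-3-2-3 m n α≡3 β≡2 γ≡3

-- Factors 2 change none of the digit sums and the claim is symmetric, so `odd-pair` applies to the
-- odd parts in the appropriate order.
two-blocks : ∀ {x y} → 0 < x → 0 < y → s₂ x + s₂ y ≤ 8 →
  s₂ x + s₂ y < s₂ (x * x) + s₂ (x * y) + s₂ (y * y)
two-blocks 0<x 0<y le with odd-part 0<x | odd-part 0<y
... | i , m , refl | j , n , refl
  rewrite s₂-2^* i (1 + 2 * m) | s₂-2^* j (1 + 2 * n)
        | s₂-odd-parts i i (1 + 2 * m) (1 + 2 * m) | s₂-odd-parts i j (1 + 2 * m) (1 + 2 * n)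
        | s₂-odd-parts j j (1 + 2 * n) (1 + 2 * n)
  with ≤-total (s₂ (1 + 2 * n)) (s₂ (1 + 2 * m))
... | inj₁ y≤x = odd-pair m n y≤x le
... | inj₂ x≤y = subst₂ _<_ (+-comm (s₂ y) (s₂ x))
        (trans (cong (λ p → s₂ (y * y) + s₂ p + s₂ (x * x)) (*-comm y x)) (lemma (s₂ (y * y)) (s₂ (x * y)) (s₂ (x * x))))
        (odd-pair n m x≤y (subst (_≤ 8) (+-comm (s₂ x) (s₂ y)) le))
  where
  x = 1 + 2 * m
  y = 1 + 2 * n
  lemma : ∀ a b c → a + b + c ≡ c + b + a
  lemma = solve-∀

-- The lower bounds p for s₂ (x²) + s₂ (xy) available when s₂ x = w and s₂ y = v.
EndBound : ℕ → ℕ → ℕ → Set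
EndBound w v p = w + v ≤ p ⊎ (2 ≤ w × 2 ≤ v × 4 ≤ p × (w ≤ 4 ⊎ 5 ≤ p))

-- If one factor is a power of two, `x * y` has the digit sum of the other one. Otherwise both
-- products have digit sum at least 2, and the square at least 3 once `s₂ x` > 4.
end-blocks : ∀ {x y} → 0 < x → 0 < y → EndBound (s₂ x) (s₂ y) (s₂ (x * x) + s₂ (x * y))
end-blocks {x} {y} 0<x 0<y with m≤n⇒m<n∨m≡n (s₂>0 0<x) | m≤n⇒m<n∨m≡n (s₂>0 0<y)
... | inj₂ 1≡ | _ = inj₁ (≤-trans (≤-reflexive (cong₂ _+_ (sym 1≡) (sym (s₂-product-unit {x} y (sym 1≡)))))
                           (+-monoˡ-≤ (s₂ (x * y)) (s₂-product>0 0<x 0<x)))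
... | inj₁ 2≤x | inj₂ 1≡ = inj₁ (begin
  s₂ x + s₂ y             ≡⟨ cong₂ _+_ (s₂-product-unit {y} x (sym 1≡)) 1≡ ⟨
  s₂ (y * x) + 1          ≡⟨ +-comm (s₂ (y * x)) 1 ⟩
  1 + s₂ (y * x)          ≤⟨ +-mono-≤ (s₂-product>0 0<x 0<x) (≤-reflexive (cong s₂ (*-comm y x))) ⟩
  s₂ (x * x) + s₂ (x * y) ∎)
  where open ≤-Reasoning
... | inj₁ 2≤x | inj₁ 2≤y = inj₂ (2≤x , 2≤y , +-mono-≤ (s₂-product≥2 {x} 2≤x 0<x) 2≤β , large (s₂ x ≤? 4))
  where
  2≤β = s₂-product≥2 {x} 2≤x 0<y
  large : _ → s₂ x ≤ 4 ⊎ 5 ≤ s₂ (x * x) + s₂ (x * y)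
  large (yes p) = inj₁ p
  large (no ¬p) = inj₂ (+-mono-≤ (s₂-square≥3 {x} (≤-trans (m≤m+n 3 2) (≰⇒> ¬p))) 2≤β)

-- Convolution squares of digit sequences

-- Polynomials with coefficients in ℕ are sequences d : ℕ → ℕ together with a bound m on their length.

eval : ℕ → ℕ → (ℕ → ℕ) → ℕ
eval X zero    d = 0
eval X (suc m) d = d 0 + X * eval X m (d ∘ suc)

conv : (ℕ → ℕ) → (ℕ → ℕ) → ℕ → ℕ
conv d e zero    = d 0 * e 0
conv d e (suc p) = d 0 * e (suc p) + conv (d ∘ suc) e p

Vanishes≥ : ℕ → (ℕ → ℕ) → Set
Vanishes≥ m d = ∀ i → m ≤ i → d i ≡ 0

eval-zero : ∀ X m {d} → Vanishes≥ 0 d → eval X m d ≡ 0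
eval-zero X zero    _ = refl
eval-zero X (suc m) v = cong₂ _+_ (v 0 z≤n)
  (trans (cong (X *_) (eval-zero X m (λ i _ → v (suc i) z≤n))) (*-zeroʳ X))

eval-extend : ∀ X m j {d} → Vanishes≥ m d → eval X (m + j) d ≡ eval X m d
eval-extend X zero    j v = eval-zero X j v
eval-extend X (suc m) j {d} v = cong (λ t → d 0 + X * t) (eval-extend X m j (λ i m≤i → v (suc i) (s≤s m≤i)))

eval-+ : ∀ X m c d → eval X m (λ i → c i + d i) ≡ eval X m c + eval X m d
eval-+ X zero    c d = refl
eval-+ X (suc m) c d rewrite eval-+ X m (c ∘ suc) (d ∘ suc) =
  lemma (c 0) (d 0) X (eval X m (c ∘ suc)) (eval X m (d ∘ suc))
  where
  lemma : ∀ a b X s t → a + b + X * (s + t) ≡ a + X * s + (b + X * t)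
  lemma = solve-∀

eval-* : ∀ X m a d → eval X m (λ i → a * d i) ≡ a * eval X m d
eval-* X zero    a d = sym (*-zeroʳ a)
eval-* X (suc m) a d rewrite eval-* X m a (d ∘ suc) = lemma a (d 0) X (eval X m (d ∘ suc))
  where
  lemma : ∀ a b X s → a * b + X * (a * s) ≡ a * (b + X * s)
  lemma = solve-∀

conv-zero : ∀ d e p → (∀ i j → i + j ≡ p → d i * e j ≡ 0) → conv d e p ≡ 0
conv-zero d e zero    z = z 0 0 refl
conv-zero d e (suc p) z = cong₂ _+_ (z 0 (suc p) refl)
  (conv-zero (d ∘ suc) e p (λ i j eq → z (suc i) j (cong suc eq)))

-- Needed at X = 2ᴸ for the product of integers, and at X = 1, where the multiplicativity of the
-- coefficient sum bounds the coefficients of P².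
eval-conv : ∀ X m n {d e} → Vanishes≥ m d → Vanishes≥ n e →
            eval X (m + n) (conv d e) ≡ eval X m d * eval X n e
eval-conv X zero n {d} {e} vd ve =
  eval-zero X n (λ p _ → conv-zero d e p (λ i j _ → cong (_* e j) (vd i z≤n)))
eval-conv X (suc m) n {d} {e} vd ve = begin
  d 0 * e 0 + X * eval X (m + n) (λ p → d 0 * e (suc p) + conv (d ∘ suc) e p)
    ≡⟨ cong (λ t → d 0 * e 0 + X * t) (eval-+ X (m + n) (λ p → d 0 * e (suc p)) (conv (d ∘ suc) e)) ⟩
  d 0 * e 0 + X * (eval X (m + n) (λ p → d 0 * e (suc p)) + eval X (m + n) (conv (d ∘ suc) e))
    ≡⟨ cong₂ (λ s t → d 0 * e 0 + X * (s + t)) (eval-* X (m + n) (d 0) (e ∘ suc))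
         (eval-conv X m n (λ i m≤i → vd (suc i) (s≤s m≤i)) ve) ⟩
  d 0 * e 0 + X * (d 0 * eval X (m + n) (e ∘ suc) + eval X m (d ∘ suc) * eval X n e)
    ≡⟨ lemma (d 0) (e 0) X (eval X (m + n) (e ∘ suc)) (eval X m (d ∘ suc)) (eval X n e) ⟩
  d 0 * eval X (suc m + n) e + X * eval X m (d ∘ suc) * eval X n e
    ≡⟨ cong (λ t → d 0 * t + X * eval X m (d ∘ suc) * eval X n e)
         (trans (cong (λ k → eval X k e) (+-comm (suc m) n)) (eval-extend X n (suc m) ve)) ⟩
  d 0 * eval X n e + X * eval X m (d ∘ suc) * eval X n e
    ≡⟨ *-distribʳ-+ (eval X n e) (d 0) (X * eval X m (d ∘ suc)) ⟨
  eval X (suc m) d * eval X n e ∎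
  where
  open ≡-Reasoning
  lemma : ∀ a b X s t u → a * b + X * (a * s + t * u) ≡ a * (b + X * s) + X * t * u
  lemma = solve-∀

-- Digit sums in the absence of carries

coefficient≤eval₁ : ∀ m {c i} → i < m → c i ≤ eval 1 m c
coefficient≤eval₁ (suc m) {c} {zero}  _         = m≤m+n (c 0) _
coefficient≤eval₁ (suc m) {c} {suc i} (s≤s i<m) = begin
  c (suc i)                    ≤⟨ coefficient≤eval₁ m i<m ⟩
  eval 1 m (c ∘ suc)           ≡⟨ *-identityˡ _ ⟨
  1 * eval 1 m (c ∘ suc)       ≤⟨ m≤n+m _ (c 0) ⟩
  c 0 + 1 * eval 1 m (c ∘ suc) ∎
  where open ≤-Reasoning

-- Unlike `eval`, the recursion removes the last term, so that contributions accumulate from the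
-- lowest degree upwards.
digitSum : ℕ → (ℕ → ℕ) → ℕ
digitSum zero    c = 0
digitSum (suc m) c = digitSum m c + s₂ (c m)

digitSum-front : ∀ m c → digitSum (suc m) c ≡ s₂ (c 0) + digitSum m (c ∘ suc)
digitSum-front zero    c = +-comm 0 (s₂ (c 0))
digitSum-front (suc m) c = trans (cong (_+ s₂ (c (suc m))) (digitSum-front m c))
  (+-assoc (s₂ (c 0)) (digitSum m (c ∘ suc)) (s₂ (c (suc m))))

s₂-eval : ∀ L m {c} → (∀ i → i < m → c i < 2 ^ L) → s₂ (eval (2 ^ L) m c) ≡ digitSum m c
s₂-eval L zero    _ = refl
s₂-eval L (suc m) {c} c< = begin
  s₂ (c 0 + 2 ^ L * eval (2 ^ L) m (c ∘ suc))      ≡⟨ s₂-concat L (eval (2 ^ L) m (c ∘ suc)) (c< 0 z<s) ⟩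
  s₂ (c 0) + s₂ (eval (2 ^ L) m (c ∘ suc))         ≡⟨ cong (s₂ (c 0) +_) (s₂-eval L m (λ i i<m → c< (suc i) (s≤s i<m))) ⟩
  s₂ (c 0) + digitSum m (c ∘ suc)                  ≡⟨ digitSum-front m c ⟨
  digitSum (suc m) c                               ∎
  where open ≡-Reasoning

digitSum-mono : ∀ {p q} c → p ≤ q → digitSum p c ≤ digitSum q c
digitSum-mono {q = zero}  c z≤n = z≤n
digitSum-mono {q = suc q} c p≤q with m≤n⇒m<n∨m≡n p≤q
... | inj₁ (s≤s p≤q′) = ≤-trans (digitSum-mono c p≤q′) (m≤m+n _ _)
... | inj₂ refl       = ≤-refl

-- Collects lower bounds for coefficients at increasing degrees, ignoring those in between.
digitSum-step : ∀ {A B p q c} → A ≤ digitSum p c → B ≤ s₂ (c p) → p < q → A + B ≤ digitSum q c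
digitSum-step {c = c} A≤ B≤ p<q = ≤-trans (+-mono-≤ A≤ B≤) (digitSum-mono c p<q)

digitSum-gap : ∀ {p q} c → p ≤ q → (∀ i → p ≤ i → i < q → c i ≡ 0) → digitSum q c ≡ digitSum p c
digitSum-gap {q = zero}  c z≤n _ = refl
digitSum-gap {q = suc q} c p≤q z with m≤n⇒m<n∨m≡n p≤q
... | inj₂ refl       = refl
... | inj₁ (s≤s p≤q′) = trans
  (cong₂ (λ s x → s + s₂ x) (digitSum-gap c p≤q′ (λ i p≤i i<q → z i p≤i (<-trans i<q ≤-refl))) (z q p≤q′ ≤-refl))
  (+-identityʳ _)

-- Extreme coefficients of a convolution square

conv-single : ∀ d e p {x y} → x + y ≡ p → (∀ i j → i + j ≡ p → i ≢ x → d i * e j ≡ 0) →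
              conv d e p ≡ d x * e y
conv-single d e zero    {zero}  refl _ = refl
conv-single d e (suc p) {zero}  refl z = trans
  (cong (d 0 * e (suc p) +_) (conv-zero (d ∘ suc) e p (λ i j eq → z (suc i) j (cong suc eq) λ ())))
  (+-identityʳ _)
conv-single d e (suc p) {suc x} refl z = cong₂ _+_ (z 0 (suc p) refl λ ())
  (conv-single (d ∘ suc) e p refl (λ i j eq i≢x → z (suc i) j (cong suc eq) (i≢x ∘ suc-injective)))

conv-double : ∀ d e p {x y x′ y′} → x < x′ → x + y ≡ p → x′ + y′ ≡ p →
              (∀ i j → i + j ≡ p → i ≢ x → i ≢ x′ → d i * e j ≡ 0) →
              conv d e p ≡ d x * e y + d x′ * e y′
conv-double d e (suc p) {zero}  {x′ = suc x′} _ refl eq′ z = cong (d 0 * e (suc p) +_)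
  (conv-single (d ∘ suc) e p (suc-injective eq′)
    (λ i j eq i≢x → z (suc i) j (cong suc eq) (λ ()) (i≢x ∘ suc-injective)))
conv-double d e (suc p) {suc x} {x′ = suc x′} (s≤s x<x′) refl eq′ z = cong₂ _+_ (z 0 (suc p) refl (λ ()) (λ ()))
  (conv-double (d ∘ suc) e p x<x′ refl (suc-injective eq′)
    (λ i j eq i≢x i≢x′ → z (suc i) j (cong suc eq) (i≢x ∘ suc-injective) (i≢x′ ∘ suc-injective)))

conv-≥ : ∀ d e i j → d i * e j ≤ conv d e (i + j)
conv-≥ d e zero    zero    = ≤-refl
conv-≥ d e zero    (suc j) = m≤m+n _ _
conv-≥ d e (suc i) j       = ≤-trans (conv-≥ (d ∘ suc) e i j) (m≤n+m _ _)

s₂-conv>0 : ∀ {d} i j → 0 < d i → 0 < d j → 0 < s₂ (conv d d (i + j))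
s₂-conv>0 {d} i j di dj = s₂>0 (≤-trans (*-mono-≤ di dj) (conv-≥ d d i j))

module _ {d : ℕ → ℕ} where

  private
    left : ∀ {i} j → d i ≡ 0 → d i * d j ≡ 0
    left j eq = cong (_* d j) eq
    right : ∀ i {j} → d j ≡ 0 → d i * d j ≡ 0
    right i eq = trans (cong (d i *_) eq) (*-zeroʳ (d i))
    low : ∀ {i j a b} → i + j ≡ a + b → b < i → j < a
    low {i} {j} {a} {b} eq b<i = +-cancelˡ-< b j a (subst (b + j <_) (trans eq (+-comm a b)) (+-monoˡ-< j b<i))
    high : ∀ {i j a b} → i + j ≡ a + b → i < a → b < j
    high {i} {j} {a} {b} eq i<a = +-cancelˡ-< a b j (subst (_< a + j) eq (+-monoˡ-< j i<a))

  -- If i + j = 2a and i ≠ a, one of the two indices lies below `a`.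
  square-lowest : ∀ {a} → (∀ i → i < a → d i ≡ 0) → conv d d (a + a) ≡ d a * d a
  square-lowest {a} z = conv-single d d (a + a) refl go
    where
    go : ∀ i j → i + j ≡ a + a → i ≢ a → d i * d j ≡ 0
    go i j eq i≢a with <-cmp i a
    ... | tri< i<a _ _ = left j (z i i<a)
    ... | tri≈ _ i≡a _ = contradiction i≡a i≢a
    ... | tri> _ _ a<i = right i (z j (low eq a<i))

  square-highest : ∀ {a} → Vanishes≥ (suc a) d → conv d d (a + a) ≡ d a * d a
  square-highest {a} z = conv-single d d (a + a) refl go
    where
    go : ∀ i j → i + j ≡ a + a → i ≢ a → d i * d j ≡ 0
    go i j eq i≢a with <-cmp i a
    ... | tri< i<a _ _ = right i (z j (high eq i<a))
    ... | tri≈ _ i≡a _ = contradiction i≡a i≢a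
    ... | tri> _ _ a<i = left j (z i a<i)

  private
    -- The surviving terms `d a * d b` and `d b * d a` are equal, and doubling preserves the digit
    -- sum.
    two-terms : ∀ {a b} → a < b → (∀ i j → i + j ≡ a + b → i ≢ a → i ≢ b → d i * d j ≡ 0) →
                s₂ (conv d d (a + b)) ≡ s₂ (d a * d b)
    two-terms {a} {b} a<b z = begin
      s₂ (conv d d (a + b))         ≡⟨ cong s₂ (conv-double d d (a + b) a<b refl (+-comm b a) z) ⟩
      s₂ (d a * d b + d b * d a)    ≡⟨ cong (λ t → s₂ (d a * d b + t)) (trans (*-comm (d b) (d a)) (sym (*-identityˡ _))) ⟩
      s₂ (2 * (d a * d b))          ≡⟨ s₂-even (d a * d b) ⟩
      s₂ (d a * d b)                ∎
      where open ≡-Reasoning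

  -- Any other pair with i + j = a + b has an index below `a` or has `i` in the gap between `a` and
  -- `b`.
  cross-lowest : ∀ {a b} → a < b → (∀ i → i < a → d i ≡ 0) → (∀ i → a < i → i < b → d i ≡ 0) →
                 s₂ (conv d d (a + b)) ≡ s₂ (d a * d b)
  cross-lowest {a} {b} a<b z gap = two-terms a<b go
    where
    go : ∀ i j → i + j ≡ a + b → i ≢ a → i ≢ b → d i * d j ≡ 0
    go i j eq i≢a i≢b with <-cmp i a | <-cmp i b
    ... | tri< i<a _ _ | _ = left j (z i i<a)
    ... | tri≈ _ i≡a _ | _ = contradiction i≡a i≢a
    ... | tri> _ _ a<i | tri< i<b _ _ = left j (gap i a<i i<b)
    ... | tri> _ _ _   | tri≈ _ i≡b _ = contradiction i≡b i≢b
    ... | tri> _ _ _   | tri> _ _ b<i = right i (z j (low eq b<i))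

  cross-highest : ∀ {a b} → a < b → (∀ i → a < i → i < b → d i ≡ 0) → Vanishes≥ (suc b) d →
                  s₂ (conv d d (a + b)) ≡ s₂ (d a * d b)
  cross-highest {a} {b} a<b gap z = two-terms a<b go
    where
    go : ∀ i j → i + j ≡ a + b → i ≢ a → i ≢ b → d i * d j ≡ 0
    go i j eq i≢a i≢b with <-cmp i a | <-cmp i b
    ... | tri< i<a _ _ | _ = right i (z j (high eq i<a))
    ... | tri≈ _ i≡a _ | _ = contradiction i≡a i≢a
    ... | tri> _ _ a<i | tri< i<b _ _ = left j (gap i a<i i<b)
    ... | tri> _ _ _   | tri≈ _ i≡b _ = contradiction i≡b i≢b
    ... | tri> _ _ _   | tri> _ _ b<i = left j (z i b<i)

-- Comparison of the digit sums of P and P²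

first-nonzero : ∀ {m d} → Vanishes≥ m d → ∀ p →
  Vanishes≥ p d ⊎ ∃ λ q → p ≤ q × 0 < d q × (∀ i → p ≤ i → i < q → d i ≡ 0)
first-nonzero {m} {d} v p = go m p (m≤n+m m p)
  where
  go : ∀ k p → m ≤ p + k → Vanishes≥ p d ⊎ ∃ λ q → p ≤ q × 0 < d q × (∀ i → p ≤ i → i < q → d i ≡ 0)
  go zero    p m≤ = inj₁ (λ i p≤i → v i (≤-trans m≤ (≤-trans (≤-reflexive (+-identityʳ p)) p≤i)))
  go (suc k) p m≤ with d p in eq
  ... | suc _ = inj₂ (p , ≤-refl , subst (0 <_) (sym eq) z<s , λ i p≤i i<p → contradiction p≤i (<⇒≱ i<p))
  ... | zero with go k (suc p) (subst (m ≤_) (+-suc p k) m≤)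
  ...   | inj₁ z = inj₁ (λ i p≤i → from z i (m≤n⇒m<n∨m≡n p≤i))
    where
    from : Vanishes≥ (suc p) d → ∀ i → p < i ⊎ p ≡ i → d i ≡ 0
    from z i (inj₁ p<i)  = z i p<i
    from z i (inj₂ refl) = eq
  ...   | inj₂ (q , p<q , dq , z) = inj₂ (q , <⇒≤ p<q , dq , λ i p≤i i<q → from i (m≤n⇒m<n∨m≡n p≤i) i<q)
    where
    from : ∀ i → p < i ⊎ p ≡ i → i < q → d i ≡ 0
    from i (inj₁ p<i)  i<q = z i p<i i<q
    from i (inj₂ refl) _   = eq

-- The 1 comes from the degree 2a₂. If one end satisfies the additive bound, the other only has to
-- cover its own block, which is `middle`. If neither does, 4 + 1 + 4 exceeds 8.
three-blocks : ∀ {w₁ w₂ w₃ p q} → EndBound w₁ w₂ p → EndBound w₃ w₂ q → 1 ≤ w₁ → 1 ≤ w₃ →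
  w₁ + w₂ + w₃ ≤ 8 → w₁ + w₂ + w₃ < p + 1 + q
three-blocks {w₁} {w₂} {w₃} {p} {q} l r 1≤w₁ 1≤w₃ ≤8 = go l r
  where
  extra : w₁ + w₂ + w₃ ≤ p + q → w₁ + w₂ + w₃ < p + 1 + q
  extra le = ≤-trans (s≤s le) (≤-reflexive (lemma p q))
    where
    lemma : ∀ p q → 1 + (p + q) ≡ p + 1 + q
    lemma = solve-∀
  swap : ∀ a b c → a + b + c ≡ a + (c + b)
  swap = solve-∀
  cyc : ∀ a b c → c + b + a ≡ a + b + c
  cyc = solve-∀
  middle : ∀ {w w′ v p} → 1 ≤ w′ → 2 ≤ v → w′ + v + w ≤ 8 → 4 ≤ p → w ≤ 4 ⊎ 5 ≤ p → w ≤ p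
  middle _ _ _ 4≤p (inj₁ w≤4) = ≤-trans w≤4 4≤p
  middle {w} 1≤w′ 2≤v ≤8 _ (inj₂ 5≤p) = ≤-trans (+-cancelˡ-≤ 3 w 5 (≤-trans (+-monoˡ-≤ w (+-mono-≤ 1≤w′ 2≤v)) ≤8)) 5≤p
  go : EndBound w₁ w₂ p → EndBound w₃ w₂ q → w₁ + w₂ + w₃ < p + 1 + q
  go (inj₁ l) (inj₁ r) = extra (+-mono-≤ l (≤-trans (m≤m+n w₃ w₂) r))
  go (inj₁ l) (inj₂ (_ , 2≤w₂ , 4≤q , r)) = extra (+-mono-≤ l (middle 1≤w₁ 2≤w₂ ≤8 4≤q r))
  go (inj₂ (_ , 2≤w₂ , 4≤p , l)) (inj₁ r) = extra (≤-trans (≤-reflexive (swap w₁ w₂ w₃))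
    (+-mono-≤ (middle 1≤w₃ 2≤w₂ (≤-trans (≤-reflexive (cyc w₁ w₂ w₃)) ≤8) 4≤p l) r))
  go (inj₂ (_ , _ , 4≤p , _)) (inj₂ (_ , _ , 4≤q , _)) =
    ≤-trans (s≤s ≤8) (+-mono-≤ (+-monoˡ-≤ 1 4≤p) 4≤q)

-- The 3 comes from the degrees 2a₂, a₂ + a₃ and 2a₃. An end without the additive bound still has 3
-- + 4 = 7 to set against its pair of blocks, which is at most 6 because the other two blocks are
-- nonzero.
four-blocks : ∀ {w₁ w₂ w₃ w₄ p q} → EndBound w₁ w₂ p → EndBound w₄ w₃ q → 1 ≤ w₁ → 1 ≤ w₂ → 1 ≤ w₃ → 1 ≤ w₄ →
  w₁ + w₂ + w₃ + w₄ ≤ 8 → w₁ + w₂ + w₃ + w₄ < p + 3 + q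
four-blocks {w₁} {w₂} {w₃} {w₄} {p} {q} l r 1≤w₁ 1≤w₂ 1≤w₃ 1≤w₄ ≤8 = go l r
  where
  regroup : ∀ a b c d → a + b + c + d ≡ (a + b) + (d + c)
  regroup = solve-∀
  pairs≤8 : (w₁ + w₂) + (w₄ + w₃) ≤ 8
  pairs≤8 = subst (_≤ 8) (regroup w₁ w₂ w₃ w₄) ≤8
  goal : ∀ {x} → (w₁ + w₂) + (w₄ + w₃) < x → w₁ + w₂ + w₃ + w₄ < x
  goal {x} = subst (_< x) (sym (regroup w₁ w₂ w₃ w₄))
  go : EndBound w₁ w₂ p → EndBound w₄ w₃ q → w₁ + w₂ + w₃ + w₄ < p + 3 + q
  go (inj₁ l) (inj₁ r) = goal (+-mono-<-≤ (≤-<-trans l (m<m+n p z<s)) r)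
  go (inj₁ l) (inj₂ (_ , _ , 4≤q , _)) = goal (≤-trans (+-mono-≤-< l (s≤s pair≤6))
    (≤-trans (≤-reflexive (sym (+-assoc p 3 4))) (+-monoʳ-≤ (p + 3) 4≤q)))
    where
    pair≤6 : w₄ + w₃ ≤ 6
    pair≤6 = +-cancelˡ-≤ 2 _ 6 (≤-trans (+-monoˡ-≤ (w₄ + w₃) (+-mono-≤ 1≤w₁ 1≤w₂)) pairs≤8)
  go (inj₂ (_ , _ , 4≤p , _)) (inj₁ r) = goal (+-mono-<-≤ (≤-trans (s≤s pair≤6) (+-monoˡ-≤ 3 4≤p)) r)
    where
    pair≤6 : w₁ + w₂ ≤ 6
    pair≤6 = +-cancelʳ-≤ 2 _ 6 (≤-trans (+-monoʳ-≤ (w₁ + w₂) (+-mono-≤ 1≤w₄ 1≤w₃)) pairs≤8)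
  go (inj₂ (_ , _ , 4≤p , _)) (inj₂ (_ , _ , 4≤q , _)) = ≤-trans (s≤s ≤8)
    (≤-trans (m≤m+n 9 2) (+-mono-≤ (+-monoˡ-≤ 3 4≤p) 4≤q))

-- The support a₁ < a₂ < ... is searched until the tail vanishes. `S₁`, `S₂`, ... give the digit sum
-- of `d` below the current term, and `C₂`, `C₃`, `C₄` bound that of the square below the next
-- degree to be counted.
digitSum-square : ∀ {m d x y} → Vanishes≥ m d → x < y → 0 < d x → 0 < d y → digitSum m d ≤ 8 →
  digitSum m d < digitSum (m + m) (conv d d)
digitSum-square {m} {d} {x} {y} v x<y dx dy ≤8 = one (first-nonzero v 0)
  where
  c = conv d d
  support< : ∀ {a} → 0 < d a → a < m
  support< {a} da = ≰⇒> (λ m≤a → contradiction (v a m≤a) (n>0⇒n≢0 da))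
  last : ∀ {p} → Vanishes≥ (suc p) d → 0 < d p → digitSum m d ≡ digitSum p d + s₂ (d p)
  last z dp = digitSum-gap d (support< dp) (λ i p<i _ → z i p<i)
  sum-lt : ∀ {w r} → digitSum m d ≡ w → (w ≤ 8 → w < r) → r ≤ digitSum (m + m) c → digitSum m d < digitSum (m + m) c
  sum-lt refl lt le = <-≤-trans (lt ≤8) le
  nz : ∀ {a b} → 0 < d a → 0 < d b → 1 ≤ s₂ (c (a + b))
  nz {a} {b} = s₂-conv>0 {d} a b
  before : ∀ {a b} → a < b → a + a < a + b
  before {a} = +-monoʳ-< a
  after : ∀ {a b} → a < b → a + b < b + b
  after {b = b} = +-monoˡ-< b

  one : _ → digitSum m d < digitSum (m + m) c
  one (inj₁ z) = contradiction (z x z≤n) (n>0⇒n≢0 dx)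
  one (inj₂ (a₁ , _ , d₁ , z₀)) = two (first-nonzero v (suc a₁))
    where
    z₁ : ∀ i → i < a₁ → d i ≡ 0
    z₁ i = z₀ i z≤n
    S₁ : digitSum a₁ d ≡ 0
    S₁ = digitSum-gap d z≤n z₀
    two : _ → digitSum m d < digitSum (m + m) c
    two (inj₁ z) = contradiction (z y (≤-<-trans (≮⇒≥ λ x<a₁ → n>0⇒n≢0 dx (z₁ x x<a₁)) x<y)) (n>0⇒n≢0 dy)
    two (inj₂ (a₂ , a₁<a₂ , d₂ , z₂)) = three (first-nonzero v (suc a₂))
      where
      S₂ : digitSum a₂ d ≡ s₂ (d a₁)
      S₂ = trans (digitSum-gap d a₁<a₂ z₂) (cong (_+ s₂ (d a₁)) S₁)
      l₁ : s₂ (d a₁ * d a₁) ≤ s₂ (c (a₁ + a₁))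
      l₁ = ≤-reflexive (cong s₂ (sym (square-lowest z₁)))
      l₂ : s₂ (d a₁ * d a₂) ≤ s₂ (c (a₁ + a₂))
      l₂ = ≤-reflexive (sym (cross-lowest a₁<a₂ z₁ z₂))
      C₂ : s₂ (d a₁ * d a₁) + s₂ (d a₁ * d a₂) ≤ digitSum (a₂ + a₂) c
      C₂ = digitSum-step {c = c} (digitSum-step {c = c} z≤n l₁ (before a₁<a₂)) l₂ (after a₁<a₂)
      three : _ → digitSum m d < digitSum (m + m) c
      three (inj₁ z) = sum-lt (trans (last z d₂) (cong (_+ s₂ (d a₂)) S₂)) (two-blocks d₁ d₂)
        (digitSum-step {c = c} C₂ (≤-reflexive (cong s₂ (sym (square-highest z)))) (+-mono-< (support< d₂) (support< d₂)))
      three (inj₂ (a₃ , a₂<a₃ , d₃ , z₃)) = four (first-nonzero v (suc a₃))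
        where
        S₃ : digitSum a₃ d ≡ s₂ (d a₁) + s₂ (d a₂)
        S₃ = trans (digitSum-gap d a₂<a₃ z₃) (cong (_+ s₂ (d a₂)) S₂)
        C₃ : s₂ (d a₁ * d a₁) + s₂ (d a₁ * d a₂) + 1 ≤ digitSum (a₂ + a₃) c
        C₃ = digitSum-step {c = c} C₂ (nz d₂ d₂) (before a₂<a₃)
        four : _ → digitSum m d < digitSum (m + m) c
        four (inj₁ z) = sum-lt (trans (last z d₃) (cong (_+ s₂ (d a₃)) S₃))
          (three-blocks (end-blocks d₁ d₂) (end-blocks d₃ d₂) (s₂>0 d₁) (s₂>0 d₃))
          (≤-trans (≤-reflexive (trans (cong (λ p → A + 1 + (s₂ (d a₃ * d a₃) + s₂ p)) (*-comm (d a₃) (d a₂)))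
                     (regroup (A + 1) (s₂ (d a₃ * d a₃)) (s₂ (d a₂ * d a₃)))))
            (digitSum-step {c = c}
              (digitSum-step {c = c} C₃ (≤-reflexive (sym (cross-highest a₂<a₃ z₃ z))) (after a₂<a₃))
              (≤-reflexive (cong s₂ (sym (square-highest z)))) (+-mono-< (support< d₃) (support< d₃))))
          where
          A = s₂ (d a₁ * d a₁) + s₂ (d a₁ * d a₂)
          regroup : ∀ a b c → a + (b + c) ≡ a + c + b
          regroup = solve-∀
        four (inj₂ (a₄ , a₃<a₄ , d₄ , z₄)) = five (first-nonzero v (suc a₄))
          where
          S₄ : digitSum a₄ d ≡ s₂ (d a₁) + s₂ (d a₂) + s₂ (d a₃)
          S₄ = trans (digitSum-gap d a₃<a₄ z₄) (cong (_+ s₂ (d a₃)) S₃)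
          C₄ : s₂ (d a₁ * d a₁) + s₂ (d a₁ * d a₂) + 1 + 1 + 1 ≤ digitSum (a₃ + a₄) c
          C₄ = digitSum-step {c = c} (digitSum-step {c = c} C₃ (nz d₂ d₃) (after a₂<a₃)) (nz d₃ d₃) (before a₃<a₄)
          five : _ → digitSum m d < digitSum (m + m) c
          five (inj₁ z) = sum-lt (trans (last z d₄) (cong (_+ s₂ (d a₄)) S₄))
            (four-blocks (end-blocks d₁ d₂) (end-blocks d₄ d₃) (s₂>0 d₁) (s₂>0 d₂) (s₂>0 d₃) (s₂>0 d₄))
            (≤-trans (≤-reflexive (trans (cong (λ p → A + 3 + (s₂ (d a₄ * d a₄) + s₂ p)) (*-comm (d a₄) (d a₃)))
                       (regroup A (s₂ (d a₄ * d a₄)) (s₂ (d a₃ * d a₄)))))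
              (digitSum-step {c = c}
                (digitSum-step {c = c} C₄ (≤-reflexive (sym (cross-highest a₃<a₄ z₄ z))) (after a₃<a₄))
                (≤-reflexive (cong s₂ (sym (square-highest z)))) (+-mono-< (support< d₄) (support< d₄))))
            where
            A = s₂ (d a₁ * d a₁) + s₂ (d a₁ * d a₂)
            regroup : ∀ a b c → a + 3 + (b + c) ≡ a + 1 + 1 + 1 + c + b
            regroup = solve-∀
          -- Nine degrees contribute at least 1 each: two in `2≤A`, three more in `C₄`, and a₃ + a₄,
          -- 2a₄, a₄ + a₅, 2a₅.
          five (inj₂ (a₅ , a₄<a₅ , d₅ , z₅)) = <-≤-trans (s≤s ≤8)
            (digitSum-step {A = 8} {1} {c = c} (digitSum-step {A = 7} {1} {c = c} (digitSum-step {A = 6} {1} {c = c}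
              (digitSum-step {A = 5} {1} {c = c} (≤-trans (+-monoˡ-≤ 1 (+-monoˡ-≤ 1 (+-monoˡ-≤ 1 2≤A))) C₄)
                (nz d₃ d₄) (after a₃<a₄)) (nz d₄ d₄) (before a₄<a₅)) (nz d₄ d₅) (after a₄<a₅))
              (nz d₅ d₅) (+-mono-< (support< d₅) (support< d₅)))
            where
            2≤A : 2 ≤ s₂ (d a₁ * d a₁) + s₂ (d a₁ * d a₂)
            2≤A = +-mono-≤ (s₂-product>0 d₁ d₁) (s₂-product>0 d₁ d₂)

-- Simultaneous approximation of the exponents

-- Dirichlet's theorem on the simultaneous approximation of the fractions r i / R.
dirichlet : ∀ k Q R .{{_ : NonZero Q}} .{{_ : NonZero R}} (r : Fin k → ℕ) → ∃ λ t → 1 ≤ t × t ≤ Q ^ k ×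
  (∀ i → ∃ λ v → Q * (t * r i) < Q * (v * R) + R × Q * (v * R) < Q * (t * r i) + R)
dirichlet k Q R r = t , m<n⇒0<n∸m a<b , ≤-trans (m∸n≤m b a) (≤-pred (toℕ<n (proj₁ (proj₂ collision)))) , close
  where
  bucket< : ∀ j i → Q * (j * r i % R) / R < Q
  bucket< j i = m<n*o⇒m/o<n {o = R} (*-monoʳ-< Q (m%n<n (j * r i) R))
  -- Pigeonhole principle: for each `i` the fractional part of `j * r i / R` falls into one of `Q`
  -- intervals of length 1/Q, so two of the Q ^ k + 1 values of `j` agree in all `k` coordinates.
  bucket : Fin (suc (Q ^ k)) → Fin (Q ^ k)
  bucket j = funToFin (λ i → fromℕ< (bucket< (toℕ j) i))
  collision = pigeonhole (n<1+n (Q ^ k)) bucket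
  a = toℕ (proj₁ collision)
  b = toℕ (proj₁ (proj₂ collision))
  a<b : a < b
  a<b = proj₁ (proj₂ (proj₂ collision))
  t = b ∸ a
  same : ∀ i → Q * (a * r i % R) / R ≡ Q * (b * r i % R) / R
  same i = begin
    Q * (a * r i % R) / R                ≡⟨ toℕ-fromℕ< (bucket< a i) ⟨
    toℕ (fromℕ< (bucket< a i))           ≡⟨ cong toℕ (finToFun-funToFin (λ i → fromℕ< (bucket< a i)) i) ⟨
    toℕ (finToFun (bucket (proj₁ collision)) i)          ≡⟨ cong (λ f → toℕ (finToFun f i)) (proj₂ (proj₂ (proj₂ collision))) ⟩
    toℕ (finToFun (bucket (proj₁ (proj₂ collision))) i)  ≡⟨ cong toℕ (finToFun-funToFin (λ i → fromℕ< (bucket< b i)) i) ⟩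
    toℕ (fromℕ< (bucket< b i))           ≡⟨ toℕ-fromℕ< (bucket< b i) ⟩
    Q * (b * r i % R) / R                ∎
    where open ≡-Reasoning
  near : ∀ {x y} → x / R ≡ y / R → x < y + R
  near {x} {y} eq = begin-strict
    x                     ≡⟨ m≡m%n+[m/n]*n x R ⟩
    x % R + x / R * R     ≡⟨ cong (λ q → x % R + q * R) eq ⟩
    x % R + y / R * R     <⟨ +-mono-<-≤ (m%n<n x R) (m/n*n≤m y R) ⟩
    R + y                 ≡⟨ +-comm R y ⟩
    y + R                 ∎
    where open ≤-Reasoning
  close : ∀ i → ∃ λ v → Q * (t * r i) < Q * (v * R) + R × Q * (v * R) < Q * (t * r i) + R
  close i = v , transfer (sym balance) (near (sym (same i))) , transfer balance (near (same i))
    where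
    α = a * r i % R
    β = b * r i % R
    -- The difference of the integer parts. The fractional parts lie in the same interval, so they
    -- differ by less than 1/Q.
    v = b * r i / R ∸ a * r i / R
    quotients : v + a * r i / R ≡ b * r i / R
    quotients = m∸n+n≡m (/-monoˡ-≤ R (*-monoˡ-≤ (r i) (<⇒≤ a<b)))
    difference : v * R + β ≡ t * r i + α
    difference = +-cancelʳ-≡ (a * r i / R * R) _ _ (begin
      v * R + β + a * r i / R * R      ≡⟨ lemma v R β (a * r i / R) ⟩
      β + (v + a * r i / R) * R        ≡⟨ cong (λ q → β + q * R) quotients ⟩
      β + b * r i / R * R              ≡⟨ m≡m%n+[m/n]*n (b * r i) R ⟨
      b * r i                          ≡⟨ cong (_* r i) (m∸n+n≡m (<⇒≤ a<b)) ⟨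
      (t + a) * r i                    ≡⟨ *-distribʳ-+ (r i) t a ⟩
      t * r i + a * r i                ≡⟨ cong (t * r i +_) (m≡m%n+[m/n]*n (a * r i) R) ⟩
      t * r i + (α + a * r i / R * R)  ≡⟨ +-assoc (t * r i) α _ ⟨
      t * r i + α + a * r i / R * R    ∎)
      where
      open ≡-Reasoning
      lemma : ∀ v R β q → v * R + β + q * R ≡ β + (v + q) * R
      lemma = solve-∀
    balance : Q * (v * R) + Q * β ≡ Q * (t * r i) + Q * α
    balance = trans (sym (*-distribˡ-+ Q (v * R) β)) (trans (cong (Q *_) difference) (*-distribˡ-+ Q (t * r i) α))
    transfer : ∀ {x y p q} → x + p ≡ y + q → q < p + R → x < y + R
    transfer {x} {y} {p} {q} eq q<p+R = +-cancelʳ-< p x (y + R) (begin-strict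
      x + p         ≡⟨ eq ⟩
      y + q         <⟨ +-monoʳ-< y q<p+R ⟩
      y + (p + R)   ≡⟨ lemma y p R ⟩
      y + R + p     ∎)
      where
      open ≤-Reasoning
      lemma : ∀ y p R → y + (p + R) ≡ y + R + p
      lemma = solve-∀

-- After a shift by T, all exponents lie just above multiples of L:
-- with t from Dirichlet's theorem, L = ⌊R/t⌋ and T slightly above L/16.
module Period (N R t : ℕ) (R≥ : N * (16 * (N + 1)) ≤ R) .{{_ : NonZero t}} .{{_ : NonZero R}} (t≤N : t ≤ N) where

  L = R / t
  K = L / 16
  T = K + 1
  -- N absorbs the loss from rounding R/t down, one T the error in Dirichlet's theorem, and the
  -- other T the shift itself.
  Δ = N + 2 * T
  L≤R : L ≤ R
  L≤R = m/n≤m R t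
  16K≤L : K * 16 ≤ L
  16K≤L = m/n*n≤m L 16
  L≤16T : L ≤ 16 * T
  L≤16T = begin
    L                  ≡⟨ m≡m%n+[m/n]*n L 16 ⟩
    L % 16 + K * 16    ≤⟨ +-monoˡ-≤ (K * 16) (<⇒≤ (m%n<n L 16)) ⟩
    16 + K * 16        ≡⟨ lemma K ⟩
    16 * T             ∎
    where
    open ≤-Reasoning
    lemma : ∀ K → 16 + K * 16 ≡ 16 * (K + 1)
    lemma = solve-∀
  -- The lower bound on `R` is made for this: R ≥ 16(N + 1)N and t ≤ N give L ≥ 16(N + 1).
  N<K : N + 1 ≤ K
  N<K = begin
    N + 1                 ≡⟨ m*n/n≡m (N + 1) 16 ⟨
    (N + 1) * 16 / 16     ≤⟨ /-monoˡ-≤ 16 (begin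
      (N + 1) * 16                 ≡⟨ m*n/n≡m ((N + 1) * 16) t ⟨
      (N + 1) * 16 * t / t         ≤⟨ /-monoˡ-≤ t (begin
        (N + 1) * 16 * t             ≤⟨ *-monoʳ-≤ ((N + 1) * 16) t≤N ⟩
        (N + 1) * 16 * N             ≡⟨ lemma N ⟩
        N * (16 * (N + 1))           ≤⟨ R≥ ⟩
        R                            ∎) ⟩
      L                            ∎) ⟩
    K                     ∎
    where
    open ≤-Reasoning
    lemma : ∀ N → (N + 1) * 16 * N ≡ N * (16 * (N + 1))
    lemma = solve-∀
  -- Excludes carries: at most 8 exponents give coefficients with sum at most 2 ^ (3 + Δ), whose
  -- square must stay below 2ᴸ.
  6+2Δ<L : 6 + 2 * Δ < L
  6+2Δ<L = begin-strict
    6 + 2 * Δ                   ≡⟨ lemma N K ⟩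
    2 * (N + 1) + 4 * K + 8     <⟨ +-mono-≤-< (+-monoˡ-≤ (4 * K) (*-monoʳ-≤ 2 N<K)) (m<m+n 8 {2} z<s) ⟩
    2 * K + 4 * K + 10 * 1      ≤⟨ +-monoʳ-≤ (2 * K + 4 * K) (*-monoʳ-≤ 10 (≤-trans (m≤n+m 1 N) N<K)) ⟩
    2 * K + 4 * K + 10 * K      ≡⟨ lemma′ K ⟩
    K * 16                      ≤⟨ 16K≤L ⟩
    L                           ∎
    where
    open ≤-Reasoning
    lemma : ∀ N K → 6 + 2 * (N + 2 * (K + 1)) ≡ 2 * (N + 1) + 4 * K + 8
    lemma = solve-∀
    lemma′ : ∀ K → 2 * K + 4 * K + 10 * K ≡ K * 16
    lemma′ = solve-∀
  T≤Δ : T ≤ Δ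
  T≤Δ = ≤-trans (m≤m+n T (T + 0)) (m≤n+m (2 * T) N)
  Δ<L : Δ < L
  Δ<L = ≤-<-trans (≤-trans (m≤m+n Δ (Δ + 0)) (m≤n+m (2 * Δ) 6)) 6+2Δ<L
  T<L : T < L
  T<L = ≤-<-trans T≤Δ Δ<L
  R<[1+L]t : R < (1 + L) * t
  R<[1+L]t = subst (_< (1 + L) * t) (sym (m≡m%n+[m/n]*n R t)) (+-monoˡ-< (L * t) (m%n<n R t))

  module _ {r v} (r≤R : r ≤ R) (above : 16 * (t * r) < 16 * (v * R) + R) (below : 16 * (v * R) < 16 * (t * r) + R) where
    open ≤-Reasoning
    -- As tL ≤ R < (1 + L)t, dividing `below` by `t` gives 16vL ≤ 16r + L, and L ≤ 16T.
    lower : v * L ≤ r + T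
    lower = *-cancelˡ-≤ {v * L} {r + T} 16 (≤-trans (≤-pred (*-cancelʳ-< t (16 * (v * L)) (suc (16 * r + L)) (begin-strict
      16 * (v * L) * t           ≡⟨ lemma v L t ⟩
      16 * (v * (L * t))         ≤⟨ *-monoʳ-≤ 16 (*-monoʳ-≤ v (m/n*n≤m R t)) ⟩
      16 * (v * R)               <⟨ below ⟩
      16 * (t * r) + R         ≤⟨ +-monoʳ-≤ (16 * (t * r)) (<⇒≤ R<[1+L]t) ⟩
      16 * (t * r) + (1 + L) * t  ≡⟨ lemma′ t (r) L ⟩
      suc (16 * r + L) * t     ∎)))
      (≤-trans (+-monoʳ-≤ (16 * r) L≤16T) (≤-reflexive (sym (*-distribˡ-+ 16 (r) T)))))
      where
      lemma : ∀ v L t → 16 * (v * L) * t ≡ 16 * (v * (L * t))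
      lemma = solve-∀
      lemma′ : ∀ t r L → 16 * (t * r) + (1 + L) * t ≡ (1 + (16 * r + L)) * t
      lemma′ = solve-∀
    v≤t : v ≤ t
    v≤t = ≤-pred (*-cancelˡ-< 16 v (suc t) (*-cancelʳ-< R (16 * v) (16 * suc t) (begin-strict
      16 * v * R              ≡⟨ *-assoc 16 v R ⟩
      16 * (v * R)            <⟨ below ⟩
      16 * (t * r) + R      ≤⟨ +-mono-≤ (*-monoʳ-≤ 16 (*-monoʳ-≤ t r≤R)) (m≤n*m R 16) ⟩
      16 * (t * R) + 16 * R   ≡⟨ lemma t R ⟩
      16 * suc t * R          ∎)))
      where
      lemma : ∀ t R → 16 * (t * R) + 16 * R ≡ 16 * (1 + t) * R
      lemma = solve-∀
    -- R exceeds Lt by less than `t`, and v ≤ t. After division by `t` this error is at most t ≤ N.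
    vR≤ : v * R ≤ v * L * t + t * t
    vR≤ = begin
      v * R                       ≡⟨ cong (v *_) (m≡m%n+[m/n]*n R t) ⟩
      v * (R % t + L * t)         ≡⟨ lemma v (R % t) L t ⟩
      v * L * t + v * (R % t)     ≤⟨ +-monoʳ-≤ (v * L * t) (*-mono-≤ v≤t (<⇒≤ (m%n<n R t))) ⟩
      v * L * t + t * t           ∎
      where
      lemma : ∀ v ρ L t → v * (ρ + L * t) ≡ v * L * t + v * ρ
      lemma = solve-∀
    r≤ : 16 * r ≤ 16 * (v * L + t) + L
    r≤ = ≤-pred (*-cancelʳ-< t (16 * r) (suc (16 * (v * L + t) + L)) (begin-strict
      16 * r * t                              ≡⟨ lemma (r) t ⟩
      16 * (t * r)                            <⟨ above ⟩
      16 * (v * R) + R                          ≤⟨ +-mono-≤ (*-monoʳ-≤ 16 vR≤) (<⇒≤ R<[1+L]t) ⟩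
      16 * (v * L * t + t * t) + (1 + L) * t    ≡⟨ lemma′ (v * L) L t ⟩
      suc (16 * (v * L + t) + L) * t            ∎))
      where
      lemma : ∀ r t → 16 * r * t ≡ 16 * (t * r)
      lemma = solve-∀
      lemma′ : ∀ x L t → 16 * (x * t + t * t) + (1 + L) * t ≡ (1 + (16 * (x + t) + L)) * t
      lemma′ = solve-∀
    upper : r + T ≤ v * L + Δ
    upper = begin
      r + T                      ≤⟨ +-monoˡ-≤ T (*-cancelˡ-≤ {r} {v * L + t + T} 16 (≤-trans r≤ (≤-trans
                                        (+-monoʳ-≤ (16 * (v * L + t)) L≤16T) (≤-reflexive (sym (*-distribˡ-+ 16 (v * L + t) T)))))) ⟩
      v * L + t + T + T            ≤⟨ +-monoˡ-≤ T (+-monoˡ-≤ T (+-monoʳ-≤ (v * L) t≤N)) ⟩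
      v * L + N + T + T            ≡⟨ lemma (v * L) N T ⟩
      v * L + Δ                    ∎
      where
      lemma : ∀ x N T → x + N + T + T ≡ x + (N + 2 * T)
      lemma = solve-∀

-- Dirichlet's theorem with Q = 16 makes both the error and the shift about L/16, so that Δ stays
-- below L/2. Here N = 16 ^ k bounds the multiplier `t`.
common-period : ∀ k (r : Fin k → ℕ) R → (∀ i → r i ≤ R) → 16 ^ k * (16 * (16 ^ k + 1)) ≤ R →
  ∃ λ L → ∃₂ λ T Δ → 6 + 2 * Δ < L × L ≤ R × T < L × (∀ i → ∃₂ λ v δ → δ ≤ Δ × r i + T ≡ δ + v * L)
common-period k r R r≤R R≥ = from (dirichlet k 16 R r)
  where
  instance
    R≢0 : NonZero R
    R≢0 = >-nonZero (<-≤-trans (*-mono-≤ {1} (m^n>0 16 k) (*-mono-≤ {1} {16} (s≤s z≤n) (m≤n+m 1 (16 ^ k)))) R≥)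
  from : (∃ λ t → 1 ≤ t × t ≤ 16 ^ k ×
           (∀ i → ∃ λ v → 16 * (t * r i) < 16 * (v * R) + R × 16 * (v * R) < 16 * (t * r i) + R)) →
         ∃ λ L → ∃₂ λ T Δ → 6 + 2 * Δ < L × L ≤ R × T < L × (∀ i → ∃₂ λ v δ → δ ≤ Δ × r i + T ≡ δ + v * L)
  from (t , 1≤t , t≤N , close) = L , T , Δ , 6+2Δ<L , L≤R , T<L , λ i → place i (close i)
    where
    instance
      t≢0 : NonZero t
      t≢0 = >-nonZero 1≤t
    open Period (16 ^ k) R t R≥ t≤N
    place : ∀ i → (∃ λ v → 16 * (t * r i) < 16 * (v * R) + R × 16 * (v * R) < 16 * (t * r i) + R) →
            ∃₂ λ v δ → δ ≤ Δ × r i + T ≡ δ + v * L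
    place i (v , above , below) = v , r i + T ∸ v * L ,
      m≤n+o⇒m∸n≤o (r i + T) (v * L) (upper {r i} {v} (r≤R i) above below) , sym (m∸n+n≡m (lower {r i} {v} (r≤R i) above below))

-- Integers as sums of powers of two

powers : List ℕ → ℕ
powers l = sum (map (2 ^_) l)

powers-suc : ∀ l → powers (map suc l) ≡ 2 * powers l
powers-suc []      = refl
powers-suc (r ∷ l) = trans (cong (2 * 2 ^ r +_) (powers-suc l)) (sym (*-distribˡ-+ 2 (2 ^ r) (powers l)))

exponents : ∀ {n} → Binary n → ∃ λ l → length l ≡ s₂ n × powers l ≡ n
exponents 0ᵇ = [] , refl , refl
exponents (double {m} b) with exponents b
... | l , len , sum≡ = map suc l , trans (length-map suc l) (trans len (sym (s₂-even m))) ,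
                       trans (powers-suc l) (cong (2 *_) sum≡)
exponents (1+2×_ {m} b) with exponents b
... | l , len , sum≡ = 0 ∷ map suc l , trans (cong suc (trans (length-map suc l) len)) (sym (s₂-odd m)) ,
                       cong suc (trans (powers-suc l) (cong (2 *_) sum≡))

-- Oddness supplies the exponent 0, which together with the largest exponent later yields two
-- distinct positions in base 2ᴸ.
odd-exponents : ∀ n → n % 2 ≡ 1 → ∃ λ l → 0 ∈ l × length l ≡ s₂ n × powers l ≡ n
odd-exponents n odd = go (binary n) odd
  where
  go : ∀ {n} → Binary n → n % 2 ≡ 1 → ∃ λ l → 0 ∈ l × length l ≡ s₂ n × powers l ≡ n
  go (double {m} _) odd = contradiction (trans (sym odd) (trans (cong (_% 2) (*-comm 2 m)) (m*n%n≡0 m 2))) λ ()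
  go (1+2×_ {m} b) _ with exponents b
  ... | l , len , sum≡ = 0 ∷ map suc l , here refl , trans (cong suc (trans (length-map suc l) len)) (sym (s₂-odd m)) ,
                         cong suc (trans (powers-suc l) (cong (2 *_) sum≡))

powers≤ : ∀ {R} l → All (_≤ R) l → powers l ≤ length l * 2 ^ R
powers≤ []      []       = z≤n
powers≤ (r ∷ l) (p ∷ ps) = +-mono-≤ (^-monoʳ-≤ 2 p) (powers≤ l ps)

monomial : ℕ → ℕ → ℕ → ℕ
monomial zero    a zero    = a
monomial zero    a (suc q) = 0
monomial (suc u) a zero    = 0
monomial (suc u) a (suc q) = monomial u a q

monomial-self : ∀ u a → monomial u a u ≡ a
monomial-self zero    a = refl
monomial-self (suc u) a = monomial-self u a

monomial-vanishes : ∀ {m u} a → u < m → Vanishes≥ m (monomial u a)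
monomial-vanishes {u = zero}  a (s≤s _)   (suc i) _         = refl
monomial-vanishes {u = suc u} a (s≤s u<m) (suc i) (s≤s m≤i) = monomial-vanishes a u<m i m≤i

eval-monomial : ∀ X {m u} a → u < m → eval X m (monomial u a) ≡ a * X ^ u
eval-monomial X {suc m} {zero}  a _         = begin
  a + X * eval X m (λ _ → 0) ≡⟨ cong (λ e → a + X * e) (eval-zero X m (λ _ _ → refl)) ⟩
  a + X * 0                  ≡⟨ cong (a +_) (*-zeroʳ X) ⟩
  a + 0                      ≡⟨ +-identityʳ a ⟩
  a                          ≡⟨ *-identityʳ a ⟨
  a * 1                      ∎
  where open ≡-Reasoning
eval-monomial X {suc m} {suc u} a (s≤s u<m) = trans (cong (X *_) (eval-monomial X a u<m)) (lemma X a (X ^ u))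
  where
  lemma : ∀ X a P → X * (a * P) ≡ a * (X * P)
  lemma = solve-∀

-- The base-2ᴸ digits of 2ᵀ Σ 2ʳ, provided that no carries occur.
module Digits (L T : ℕ) .{{_ : NonZero L}} where

  position offset : ℕ → ℕ
  position r = (r + T) / L
  offset   r = (r + T) % L

  digits : List ℕ → ℕ → ℕ
  digits []      q = 0
  digits (r ∷ l) q = monomial (position r) (2 ^ offset r) q + digits l q

  digits-vanish : ∀ {m} l → All (λ r → position r < m) l → Vanishes≥ m (digits l)
  digits-vanish []      []       i m≤i = refl
  digits-vanish (r ∷ l) (p ∷ ps) i m≤i = cong₂ _+_ (monomial-vanishes (2 ^ offset r) p i m≤i) (digits-vanish l ps i m≤i)

  digits>0 : ∀ {r} l → r ∈ l → 0 < digits l (position r)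
  digits>0 (r ∷ l) (here refl) = ≤-trans
    (subst (0 <_) (sym (monomial-self (position r) (2 ^ offset r))) (m^n>0 2 (offset r))) (m≤m+n _ _)
  digits>0 (r ∷ l) (there r∈l) = ≤-trans (digits>0 l r∈l) (m≤n+m _ _)

  eval-digits : ∀ {m} l → All (λ r → position r < m) l → eval (2 ^ L) m (digits l) ≡ 2 ^ T * powers l
  eval-digits {m} []      []       = trans (eval-zero (2 ^ L) m (λ _ _ → refl)) (sym (*-zeroʳ (2 ^ T)))
  eval-digits {m} (r ∷ l) (p ∷ ps) = begin
    eval (2 ^ L) m (digits (r ∷ l))
      ≡⟨ eval-+ (2 ^ L) m (monomial (position r) (2 ^ offset r)) (digits l) ⟩
    eval (2 ^ L) m (monomial (position r) (2 ^ offset r)) + eval (2 ^ L) m (digits l)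
      ≡⟨ cong₂ _+_ (eval-monomial (2 ^ L) (2 ^ offset r) p) (eval-digits l ps) ⟩
    2 ^ offset r * (2 ^ L) ^ position r + 2 ^ T * powers l
      ≡⟨ cong (_+ 2 ^ T * powers l) shifted ⟩
    2 ^ T * 2 ^ r + 2 ^ T * powers l
      ≡⟨ *-distribˡ-+ (2 ^ T) (2 ^ r) (powers l) ⟨
    2 ^ T * powers (r ∷ l) ∎
    where
    open ≡-Reasoning
    shifted : 2 ^ offset r * (2 ^ L) ^ position r ≡ 2 ^ T * 2 ^ r
    shifted = begin
      2 ^ offset r * (2 ^ L) ^ position r    ≡⟨ cong (2 ^ offset r *_) (^-*-assoc 2 L (position r)) ⟩
      2 ^ offset r * 2 ^ (L * position r)    ≡⟨ ^-distribˡ-+-* 2 (offset r) (L * position r) ⟨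
      2 ^ (offset r + L * position r)        ≡⟨ cong (λ e → 2 ^ (offset r + e)) (*-comm L (position r)) ⟩
      2 ^ (offset r + position r * L)        ≡⟨ cong (2 ^_) (m≡m%n+[m/n]*n (r + T) L) ⟨
      2 ^ (r + T)                            ≡⟨ cong (2 ^_) (+-comm r T) ⟩
      2 ^ (T + r)                            ≡⟨ ^-distribˡ-+-* 2 T r ⟩
      2 ^ T * 2 ^ r                          ∎

  eval₁-digits : ∀ {m Δ} l → All (λ r → position r < m) l → All (λ r → offset r ≤ Δ) l →
                 eval 1 m (digits l) ≤ length l * 2 ^ Δ
  eval₁-digits {m} []          []       []       = ≤-reflexive (eval-zero 1 m (λ _ _ → refl))
  eval₁-digits {m} {Δ} (r ∷ l) (p ∷ ps) (o ∷ os) = begin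
    eval 1 m (digits (r ∷ l))
      ≡⟨ eval-+ 1 m (monomial (position r) (2 ^ offset r)) (digits l) ⟩
    eval 1 m (monomial (position r) (2 ^ offset r)) + eval 1 m (digits l)
      ≡⟨ cong (_+ eval 1 m (digits l)) (trans (eval-monomial 1 (2 ^ offset r) p)
           (trans (cong (2 ^ offset r *_) (^-zeroˡ (position r))) (*-identityʳ _))) ⟩
    2 ^ offset r + eval 1 m (digits l)
      ≤⟨ +-mono-≤ (^-monoʳ-≤ 2 o) (eval₁-digits l ps os) ⟩
    length (r ∷ l) * 2 ^ Δ ∎
    where open ≤-Reasoning

-- From a common period to the bound on n

All-lookup : ∀ {P : ℕ → Set} l → (∀ i → P (lookup l i)) → All P l
All-lookup []      f = []
All-lookup (x ∷ l) f = f Fin.zero ∷ All-lookup l (f ∘ Fin.suc)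

lookup-All : ∀ {P : ℕ → Set} {l} → All P l → ∀ i → P (lookup l i)
lookup-All (p ∷ _)  Fin.zero    = p
lookup-All (_ ∷ ps) (Fin.suc i) = lookup-All ps i

-- The offsets are so small that 2ᵀn and its square are read off in base 2ᴸ without carries, which
-- reduces the claim to `digitSum-square`.
aligned-exponents : ∀ {L T Δ R} .{{_ : NonZero L}} l → length l ≤ 8 → 0 ∈ l → R ∈ l → All (_≤ R) l →
  6 + 2 * Δ < L → L ≤ R → T < L → All (λ r → (r + T) % L ≤ Δ) l →
  s₂ (powers l) ≤ 8 → s₂ (powers l) < s₂ (powers l * powers l)
aligned-exponents {L} {T} {Δ} {R} l len≤8 0∈ R∈ l≤R 6+2Δ<L L≤R T<L offsets s≤8 =
  subst₂ _<_ sum≡ sumSq≡ (digitSum-square vanish 0<pos (digits>0 l 0∈) (digits>0 l R∈) (subst (_≤ 8) (sym sum≡) s≤8))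
  where
  open Digits L T
  d = digits l
  -- A crude length: a position is at most r + T ≤ R + T.
  m = suc (R + T)
  n = powers l
  -- The sum of the coefficients. It bounds each of them, and its square bounds the coefficients of
  -- `conv d d`.
  E = eval 1 m d
  positions : All (λ r → position r < m) l
  positions = All.map (λ {r} r≤R → s≤s (≤-trans (m/n≤m (r + T) L) (+-monoˡ-≤ T r≤R))) l≤R
  vanish : Vanishes≥ m d
  vanish = digits-vanish l positions
  -- T < L keeps the exponent 0 in position 0, and L ≤ R moves `R` to a later one.
  0<pos : position 0 < position R
  0<pos = subst (_< position R) (sym (m<n⇒m/n≡0 T<L)) (m≥n⇒m/n>0 (≤-trans L≤R (m≤m+n R T)))
  E≤ : E ≤ 2 ^ (3 + Δ)
  E≤ = ≤-trans (eval₁-digits l positions offsets) (≤-trans (*-monoˡ-≤ (2 ^ Δ) len≤8) (≤-reflexive (sym (^-distribˡ-+-* 2 3 Δ))))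
  E²< : E * E < 2 ^ L
  E²< = begin-strict
    E * E                        ≤⟨ *-mono-≤ E≤ E≤ ⟩
    2 ^ (3 + Δ) * 2 ^ (3 + Δ)    ≡⟨ ^-distribˡ-+-* 2 (3 + Δ) (3 + Δ) ⟨
    2 ^ (3 + Δ + (3 + Δ))        <⟨ ^-monoʳ-< 2 (s≤s (s≤s z≤n)) (subst (_< L) (lemma Δ) 6+2Δ<L) ⟩
    2 ^ L                        ∎
    where
    open ≤-Reasoning
    lemma : ∀ Δ → 6 + 2 * Δ ≡ 3 + Δ + (3 + Δ)
    lemma = solve-∀
  square≥ : ∀ x → x ≤ x * x
  square≥ zero    = z≤n
  square≥ (suc x) = m≤m+n (suc x) _
  sum≡ : digitSum m d ≡ s₂ n
  sum≡ = begin
    digitSum m d             ≡⟨ s₂-eval L m (λ i i<m → ≤-<-trans (coefficient≤eval₁ m {d} i<m) (≤-<-trans (square≥ E) E²<)) ⟨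
    s₂ (eval (2 ^ L) m d)    ≡⟨ cong s₂ (eval-digits l positions) ⟩
    s₂ (2 ^ T * n)           ≡⟨ s₂-2^* T n ⟩
    s₂ n                     ∎
    where open ≡-Reasoning
  sumSq≡ : digitSum (m + m) (conv d d) ≡ s₂ (n * n)
  sumSq≡ = begin
    digitSum (m + m) (conv d d)              ≡⟨ s₂-eval L (m + m) (λ i i<m → ≤-<-trans (coefficient≤eval₁ (m + m) {conv d d} i<m)
                                                  (subst (_< 2 ^ L) (sym (eval-conv 1 m m vanish vanish)) E²<)) ⟨
    s₂ (eval (2 ^ L) (m + m) (conv d d))     ≡⟨ cong s₂ (eval-conv (2 ^ L) m m vanish vanish) ⟩
    s₂ (eval (2 ^ L) m d * eval (2 ^ L) m d) ≡⟨ cong₂ (λ x y → s₂ (x * y)) (eval-digits l positions) (eval-digits l positions) ⟩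
    s₂ ((2 ^ T * n) * (2 ^ T * n))           ≡⟨ s₂-odd-parts T T n n ⟩
    s₂ (n * n)                               ∎
    where open ≡-Reasoning

-- `max` may return its default value 0, which lies in the list by hypothesis.
largest : ∀ l → 0 ∈ l → max 0 l ∈ l
largest l 0∈l with argmax-sel id 0 l
... | inj₁ eq  = subst (_∈ l) (sym eq) 0∈l
... | inj₂ sel = sel

exponentBound : ℕ → ℕ
exponentBound k = 16 ^ k * (16 * (16 ^ k + 1))

period-suffices : ∀ {l} → length l ≤ 8 → 0 ∈ l → s₂ (powers l) ≤ 8 →
  (∃ λ L → ∃₂ λ T Δ → 6 + 2 * Δ < L × L ≤ max 0 l × T < L ×
    (∀ i → ∃₂ λ v δ → δ ≤ Δ × lookup l i + T ≡ δ + v * L)) →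
  s₂ (powers l) < s₂ (powers l * powers l)
period-suffices {l} len≤8 0∈l s≤8 (L , T , Δ , 6+2Δ<L , L≤R , T<L , place) =
  aligned-exponents l len≤8 0∈l (largest l 0∈l) (xs≤max 0 l) 6+2Δ<L L≤R T<L (All-lookup l offset≤) s≤8
  where
  instance
    L≢0 : NonZero L
    L≢0 = >-nonZero (≤-<-trans z≤n 6+2Δ<L)
  Δ<L : Δ < L
  Δ<L = ≤-<-trans (≤-trans (m≤m+n Δ (Δ + 0)) (m≤n+m (2 * Δ) 6)) 6+2Δ<L
  offset≤ : ∀ i → (lookup l i + T) % L ≤ Δ
  offset≤ i with place i
  ... | v , δ , δ≤Δ , eq = subst (_≤ Δ) (sym (trans (cong (_% L) eq)
                             (trans ([m+kn]%n≡m%n δ v L) (m<n⇒m%n≡m (≤-<-trans δ≤Δ Δ<L))))) δ≤Δ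

-- If the largest exponent were below `exponentBound (length l)`, then `powers≤` would contradict
-- the size of the sum. So `common-period` applies.
s₂-square-increases : ∀ l → length l ≤ 8 → 0 ∈ l → length l * 2 ^ exponentBound (length l) < powers l →
  s₂ (powers l) ≤ 8 → s₂ (powers l) < s₂ (powers l * powers l)
s₂-square-increases l len≤8 0∈l large s≤8 = period-suffices len≤8 0∈l s≤8
  (common-period (length l) (lookup l) (max 0 l) (lookup-All (xs≤max 0 l)) (≮⇒≥ λ R< →
    contradiction large (≤⇒≯ (≤-trans (powers≤ l (xs≤max 0 l)) (*-monoʳ-≤ (length l) (^-monoʳ-≤ 2 (<⇒≤ R<)))))))

theorem1p3 : (k : ℕ) → 1 ≤ k → k ≤ 8 →
    ∃ λ B → (n : ℕ) → 1 ≤ n → n % 2 ≡ 1 → s₂ (n * n) ≡ k → s₂ n ≡ k → n < B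
-- A sum of `k` powers of two above `k * 2 ^ exponentBound k` has an exponent of at least
-- `exponentBound k`. The `suc` makes the bound strict.
theorem1p3 k _ k≤8 = suc (k * 2 ^ exponentBound k) , bounded
  where
  bounded : (n : ℕ) → 1 ≤ n → n % 2 ≡ 1 → s₂ (n * n) ≡ k → s₂ n ≡ k → n < suc (k * 2 ^ exponentBound k)
  bounded n _ odd sq≡ s≡ with odd-exponents n odd
  ... | l , 0∈l , len , refl = s≤s (≮⇒≥ λ large → <-irrefl (trans s≡ (sym sq≡))
          (s₂-square-increases l (subst (_≤ 8) (sym len≡k) k≤8) 0∈l
            (subst (λ k → k * 2 ^ exponentBound k < powers l) (sym len≡k) large) (subst (_≤ 8) (sym s≡) k≤8)))
    where
    len≡k : length l ≡ k
    len≡k = trans len s≡
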